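{- Let $n\geq 4$, let $D_n$ be the $n$-dimensional dual cube and let $S=\{x,y,z,w\}$ be a set of four distinct vertices of $D_n$. If the vertices of $S$ lie in exactly two clusters of $D_n$, then there are $n-1$ internally disjoint trees connecting $S$ in $D_n$.
   Context: The $n$-dimensional dual cube $D_n$ has vertex set all binary strings $u_1u_2\cdots u_{2n-1}$ of length $2n-1$; two vertices $u,v$ are adjacent iff they differ in exactly one bit position $i$, and either $1\leq i\leq n-1$ and $u_{2n-1}=v_{2n-1}=0$, or $n\leq i\leq 2n-2$ and $u_{2n-1}=v_{2n-1}=1$, or $i=2n-1$. A cluster of class $0$ is the set of vertices with last bit $0$ and fixed bits in positions $n,\dots,2n-2$; a cluster of class $1$ is the set of vertices with last bit $1$ and fixed bits in positions $1,\dots,n-1$; each induces a copy of $Q_{n-1}$, and the clusters partition $V(D_n)$. Trees $T_1,\dots,T_m$ in a graph $G$ are internally disjoint trees connecting $S$ (or $S$-trees) if each $T_i$ is a tree containing $S$, the trees are pairwise edge-disjoint, and $V(T_i)\cap V(T_j)=S$ for all $i\neq j$. -}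

module Defs where

open import Data.Nat using (ℕ; zero; suc; _∸_; _≤_; _*_)
open import Data.Bool using (Bool; true; false; if_then_else_)
open import Data.Vec using (Vec; []; _∷_)
open import Data.List using (List; []; _∷_; _++_; length)
open import Data.List.Membership.Propositional using (_∈_)
open import Data.List.Relation.Unary.Unique.Propositional using (Unique)
open import Data.List.Relation.Unary.Linked using (Linked)
open import Data.List.Relation.Unary.All using (All)
open import Data.List.Relation.Unary.Any using (Any)
open import Data.Fin using (Fin)
open import Data.Product using (Σ; ∃; _×_; _,_; proj₁; proj₂)
open import Data.Sum using (_⊎_)
open import Data.Empty using (⊥)
open import Relation.Nullary using (¬_)
open import Relation.Binary.PropositionalEquality using (_≡_; _≢_)
open import Relation.Binary.Construct.Closure.ReflexiveTransitive using (Star)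

-- A finite subgraph given by a list of vertices and a list of edges
-- (each edge an ordered pair, read as an unordered edge).
record SubGraph (V : Set) : Set where
  constructor subgraph
  field
    verts : List V
    edges : List (V × V)
open SubGraph public

EdgeIn : {V : Set} → List (V × V) → V → V → Set
EdgeIn es u v = ((u , v) ∈ es) ⊎ ((v , u) ∈ es)

Connected : {V : Set} → List (V × V) → V → V → Set
Connected es = Star (EdgeIn es)

HasCycle : {V : Set} → List (V × V) → Set
HasCycle {V} es =
  Σ V λ v₀ → Σ V λ v₁ → Σ V λ v₂ → Σ (List V) λ rest →
    Unique (v₀ ∷ v₁ ∷ v₂ ∷ rest) ×
    Linked (EdgeIn es) ((v₀ ∷ v₁ ∷ v₂ ∷ rest) ++ (v₀ ∷ []))

IsTree : {V : Set} → (V → V → Set) → SubGraph V → Set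
IsTree {V} Adj T =
  Unique (verts T) ×
  (∀ u v → (u , v) ∈ edges T → Adj u v × u ∈ verts T × v ∈ verts T) ×
  (∀ u v → u ∈ verts T → v ∈ verts T → Connected (edges T) u v) ×
  ¬ HasCycle (edges T)

InternallyDisjointSTrees : {V : Set} → (V → V → Set) → List V →
                           (m : ℕ) → (Fin m → SubGraph V) → Set
InternallyDisjointSTrees {V} Adj S m T =
  (∀ i → IsTree Adj (T i) × (∀ s → s ∈ S → s ∈ verts (T i))) ×
  (∀ i j → i ≢ j →
     (∀ u v → EdgeIn (edges (T i)) u v → EdgeIn (edges (T j)) u v → ⊥) ×
     (∀ v → v ∈ verts (T i) → v ∈ verts (T j) → v ∈ S))

-- A vertex u₁…u_{2n-1} is stored as (u₁…u_{n-1}, u_n…u_{2n-2}, u_{2n-1}).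
DVertex : ℕ → Set
DVertex n = Vec Bool (n ∸ 1) × Vec Bool (n ∸ 1) × Bool

data Diff1 : {k : ℕ} → Vec Bool k → Vec Bool k → Set where
  here  : ∀ {k x y} {xs ys : Vec Bool k} → x ≢ y → xs ≡ ys → Diff1 (x ∷ xs) (y ∷ ys)
  there : ∀ {k x} {xs ys : Vec Bool k} → Diff1 xs ys → Diff1 (x ∷ xs) (x ∷ ys)

DAdj : (n : ℕ) → DVertex n → DVertex n → Set
DAdj n (a , b , c) (a' , b' , c') =
  (c ≡ false × c' ≡ false × b ≡ b' × Diff1 a a') ⊎
  (c ≡ true  × c' ≡ true  × a ≡ a' × Diff1 b b') ⊎
  (a ≡ a' × b ≡ b' × c ≢ c')

-- the cluster containing a vertex, identified by its class and the
-- fixed bits (positions n..2n-2 for class 0, positions 1..n-1 for class 1)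
ClusterId : ℕ → Set
ClusterId n = Bool × Vec Bool (n ∸ 1)

clusterOf : (n : ℕ) → DVertex n → ClusterId n
clusterOf n (a , b , c) = c , (if c then a else b)

InExactlyTwoClusters : (n : ℕ) → List (DVertex n) → Set
InExactlyTwoClusters n S =
  Σ (ClusterId n) λ C₁ → Σ (ClusterId n) λ C₂ →
    C₁ ≢ C₂ ×
    All (λ s → clusterOf n s ≡ C₁ ⊎ clusterOf n s ≡ C₂) S ×
    Any (λ s → clusterOf n s ≡ C₁) S ×
    Any (λ s → clusterOf n s ≡ C₂) S

{-# OPTIONS --safe #-}
-- Write m = n - 1. In the cube Q_m, every q and t are joined by a "fan": walks from the m
-- neighbours of q to t that are disjoint except at t. A cluster with at most three terminals carries
-- m internally disjoint connected pieces, the i-th of which meets a set C i of positions, the sets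
-- C i being pairwise disjoint. For one or two terminals this is a fan. For three terminals, two in
-- one half of the cube and the third in the other half, m - 1 pieces are made of a fan in each half
-- and the edges between them; the last piece leaves the cluster at the terminals or their
-- neighbours. Every two clusters of opposite classes are joined by exactly one edge, so a piece that
-- leaves at the positions C i can claim the clusters indexed by C i for itself, and the i-th pieces
-- of the two clusters are joined through clusters reserved for i.
module Submission where

open import Defs
open import Data.Bool using (Bool; true; false; not)
open import Data.Bool.Properties using (not-¬; ¬-not; not-involutive; not-injective) renaming (_≟_ to _≟ᵇ_)
open import Data.Empty using (⊥; ⊥-elim)
open import Data.Fin using (Fin; zero; suc)
open import Data.Fin.Properties using (suc-injective; any?) renaming (_≟_ to _≟ᶠ_)
open import Data.List using (List; []; _∷_; _++_; length; map)
open import Data.List.Membership.Propositional using (_∈_; _∉_; find)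
open import Data.List.Membership.Propositional.Properties using (∈-map⁺; ∈-map⁻)
open import Data.List.Relation.Binary.Permutation.Propositional using (_↭_; prep; ↭-refl; ↭-sym; ↭-trans; ↭⇒↭ₛ)
open import Data.List.Relation.Binary.Permutation.Propositional.Properties using (∈-resp-↭; ↭-length; shift; ++-comm)
open import Data.List.Relation.Binary.Permutation.Setoid.Properties using (Unique-resp-↭)
open import Data.List.Relation.Unary.All as All using (All; []; _∷_)
open import Data.List.Relation.Unary.All.Properties using (¬Any⇒All¬; ++⁺)
open import Data.List.Relation.Unary.AllPairs using ([]; _∷_)
open import Data.List.Relation.Unary.Any using (Any; here; there)
open import Data.List.Relation.Unary.Linked using (Linked; []; [-]; _∷_)
open import Data.List.Relation.Unary.Unique.Propositional using (Unique)
open import Data.Nat using (ℕ; zero; suc; _≤_; _∸_; s≤s)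
open import Data.Product using (Σ; ∃; ∃₂; _×_; _,_; proj₁; proj₂)
open import Data.Product.Properties using () renaming (≡-dec to ×-≡-dec)
open import Data.Sum as Sum using (_⊎_; inj₁; inj₂; [_,_]′)
open import Data.Unit using (⊤; tt)
open import Data.Vec using (Vec; []; _∷_; updateAt; lookup)
open import Data.Vec.Properties as Vec using (∷-injectiveˡ; ∷-injectiveʳ; lookup∘updateAt′; updateAt-updateAt-local; updateAt-id)
open import Function using (_∘_; id)
open import Relation.Binary using (DecidableEquality)
open import Relation.Binary.Construct.Closure.ReflexiveTransitive as Star using (Star; ε; _◅_; _◅◅_)
open import Relation.Binary.PropositionalEquality using (_≡_; _≢_; refl; sym; trans; cong; subst; subst₂; setoid)
open import Relation.Nullary using (¬_; Dec; yes; no)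
import Data.List.Membership.DecPropositional as DecMembership

-- No tree is written down by hand. It suffices to give, for each index, a symmetric edge relation
-- in which walks join all terminals; a tree is grown inside it and inherits the disjointness of the
-- relations. Three obstacles shape the rest. With three terminals in a cluster, a fan in a half of
-- the cube has only m - 1 directions. The piece that is missing need not be connected inside the
-- cluster, since its parts are joined outside; hence the exits of a piece form a set `C i`. If the
-- two clusters have the same class, exits at the same position lead from both into the same cluster
-- of the other class, so such a position must carry the same index on both sides: a common centre
-- (`CentredSide`) or a permutation of directions (`Alignment`) arranges this. If the classes are
-- opposite, an exit may be the very edge between the two clusters; it is avoided when each side has
-- two terminals, and otherwise the tree runs straight along it.

EdgeIn-sym : {V : Set} {es : List (V × V)} {u v : V} → EdgeIn es u v → EdgeIn es v u
EdgeIn-sym = Sum.swap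

-- Trees grown leaf by leaf inside a relation

TwoNeighbours : {V : Set} → (V → V → Set) → V → Set
TwoNeighbours R v = ∃₂ λ u w → u ≢ w × R v u × R v w

module _ {V : Set} {R : V → V → Set} (R-sym : ∀ {u v} → R u v → R v u) where

  linked-last : ∀ a l {z} → Linked R ((a ∷ l) ++ (z ∷ [])) → ∃ λ u → u ∈ (a ∷ l) × R u z
  linked-last a []      (e ∷ _)  = a , here refl , e
  linked-last a (b ∷ l) (_ ∷ es) with linked-last b l es
  ... | u , u∈ , e = u , there u∈ , e

  twoNeighbours-interior : ∀ a b l {z} → Linked R ((a ∷ b ∷ l) ++ (z ∷ [])) →
    Unique (a ∷ b ∷ l) → All (_≢ z) (a ∷ b ∷ l) → ∀ {v} → v ∈ (b ∷ l) → TwoNeighbours R v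
  twoNeighbours-interior a b [] (e ∷ e' ∷ _) _ (a≢z ∷ _) (here refl) =
    a , _ , a≢z , R-sym e , e'
  twoNeighbours-interior a b (c ∷ l) (e ∷ e' ∷ _) ((_ ∷ a≢c ∷ _) ∷ _) _ (here refl) =
    a , c , a≢c , R-sym e , e'
  twoNeighbours-interior a b (c ∷ l) (_ ∷ es) (_ ∷ un) (_ ∷ ≢z) (there v∈) =
    twoNeighbours-interior b c l es un ≢z v∈

  -- The closed walk lists `v₀` at both ends, so the second neighbour of `v₀` is the last vertex of
  -- the list; it differs from `v₁` because a cycle has at least three vertices.
  cycle-twoNeighbours : ∀ {v₀ v₁ v₂ l} → Unique (v₀ ∷ v₁ ∷ v₂ ∷ l) →
    Linked R ((v₀ ∷ v₁ ∷ v₂ ∷ l) ++ (v₀ ∷ [])) →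
    ∀ {v} → v ∈ (v₀ ∷ v₁ ∷ v₂ ∷ l) → TwoNeighbours R v
  cycle-twoNeighbours {v₁ = v₁} {v₂} {l} (_ ∷ (v₁∉ ∷ _)) (e ∷ _ ∷ es) (here refl)
    with linked-last v₂ l es
  ... | u , u∈ , e' = v₁ , u , All.lookup v₁∉ u∈ , e , R-sym e'
  cycle-twoNeighbours {v₀} {v₂ = v₂} ((_ ∷ v₀≢v₂ ∷ _) ∷ _) (e ∷ e' ∷ _) (there (here refl)) =
    v₀ , v₂ , v₀≢v₂ , R-sym e , e'
  cycle-twoNeighbours {v₁ = v₁} {v₂} {l} (v₀∉ ∷ un) (_ ∷ es) (there (there v∈)) =
    twoNeighbours-interior v₁ v₂ l es un (All.map (λ ne eq → ne (sym eq)) v₀∉) v∈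

linked-restrict : {V : Set} {R R' : V → V → Set} {P : V → Set} →
  (∀ {u v} → P u → P v → R u v → R' u v) → ∀ {l} → All P l → Linked R l → Linked R' l
linked-restrict f _              []       = []
linked-restrict f _              [-]      = [-]
linked-restrict f (pu ∷ pv ∷ ps) (e ∷ es) = f pu pv e ∷ linked-restrict f (pv ∷ ps) es

module _ {V : Set} (_≟_ : DecidableEquality V) (R : V → V → Set) (r : V) where

  open DecMembership _≟_ using (_∈?_)

  -- A tree is encoded by its history: every vertex but the root comes with exactly one edge, to an
  -- older vertex. Each property of a tree becomes an induction on this history.
  data Grown : List V → List (V × V) → Set where
    root : Grown (r ∷ []) []
    leaf : ∀ {vs es u v} → Grown vs es → u ∈ vs → v ∉ vs → R v u → Grown (v ∷ vs) ((v , u) ∷ es)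

  grown-unique : ∀ {vs es} → Grown vs es → Unique vs
  grown-unique root            = [] ∷ []
  grown-unique (leaf g _ v∉ _) = ¬Any⇒All¬ _ v∉ ∷ grown-unique g

  grown-edge : ∀ {vs es} → Grown vs es → ∀ {u v} → (u , v) ∈ es → R u v × u ∈ vs × v ∈ vs
  grown-edge (leaf g u∈ _ e) (here refl) = e , here refl , there u∈
  grown-edge (leaf g _ _ _)  (there m)   with grown-edge g m
  ... | e , u∈ , v∈ = e , there u∈ , there v∈

  grown-edgeIn : ∀ {vs es} → Grown vs es → ∀ {u v} → EdgeIn es u v → u ∈ vs × v ∈ vs
  grown-edgeIn g (inj₁ m) = proj₂ (grown-edge g m)
  grown-edgeIn g (inj₂ m) with grown-edge g m
  ... | _ , v∈ , u∈ = u∈ , v∈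

  grown-toRoot : ∀ {vs es} → Grown vs es → ∀ {v} → v ∈ vs → Connected es v r
  grown-toRoot root (here refl) = ε
  grown-toRoot (leaf g u∈ _ _) (here refl) =
    inj₁ (here refl) ◅ Star.map (Sum.map there there) (grown-toRoot g u∈)
  grown-toRoot (leaf g _ _ _) (there v∈) = Star.map (Sum.map there there) (grown-toRoot g v∈)

  grown-root∈ : ∀ {vs es} → Grown vs es → r ∈ vs
  grown-root∈ root           = here refl
  grown-root∈ (leaf g _ _ _) = there (grown-root∈ g)

  grown-support : ∀ {vs es} → Grown vs es → ∀ {v} → v ∈ vs → v ≡ r ⊎ ∃ (R v)
  grown-support root           (here refl) = inj₁ refl
  grown-support (leaf _ _ _ e) (here refl) = inj₂ (_ , e)
  grown-support (leaf g _ _ _) (there v∈)  = grown-support g v∈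

  grown-leafEdge : ∀ {vs es u v} → Grown vs es → v ∉ vs →
    ∀ {w} → EdgeIn ((v , u) ∷ es) v w → w ≡ u
  grown-leafEdge g v∉ (inj₁ (here refl)) = refl
  grown-leafEdge g v∉ (inj₂ (here refl)) = refl
  grown-leafEdge g v∉ (inj₁ (there m))   = ⊥-elim (v∉ (proj₁ (grown-edgeIn g (inj₁ m))))
  grown-leafEdge g v∉ (inj₂ (there m))   = ⊥-elim (v∉ (proj₁ (grown-edgeIn g (inj₂ m))))

  -- A leaf has a single neighbour, so no cycle passes through the vertex added last.
  grown-acyclic : ∀ {vs es} → Grown vs es → ¬ HasCycle es
  grown-acyclic root (_ , _ , _ , _ , _ , inj₁ () ∷ _)
  grown-acyclic root (_ , _ , _ , _ , _ , inj₂ () ∷ _)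
  grown-acyclic (leaf {es = es} {u} {v} g _ v∉ _) (v₀ , v₁ , v₂ , l , un , es') =
    grown-acyclic g (v₀ , v₁ , v₂ , l , un ,
      linked-restrict shrink (++⁺ ≢v (All.head ≢v ∷ [])) es')
    where
    v∉cycle : v ∉ (v₀ ∷ v₁ ∷ v₂ ∷ l)
    v∉cycle v∈ with cycle-twoNeighbours EdgeIn-sym un es' v∈
    ... | _ , _ , a≢b , e , e' =
      a≢b (trans (grown-leafEdge g v∉ e) (sym (grown-leafEdge g v∉ e')))
    ≢v : All (v ≢_) (v₀ ∷ v₁ ∷ v₂ ∷ l)
    ≢v = ¬Any⇒All¬ _ v∉cycle
    shrink : ∀ {a b} → v ≢ a → v ≢ b → EdgeIn ((v , u) ∷ es) a b → EdgeIn es a b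
    shrink v≢a v≢b (inj₁ (here refl)) = ⊥-elim (v≢a refl)
    shrink v≢a v≢b (inj₂ (here refl)) = ⊥-elim (v≢b refl)
    shrink v≢a v≢b (inj₁ (there m))   = inj₁ m
    shrink v≢a v≢b (inj₂ (there m))   = inj₂ m

  Extension : List V → (List V → Set) → Set
  Extension vs Q = ∃₂ λ vs' es' → Grown vs' es' × (∀ {v} → v ∈ vs → v ∈ vs') × Q vs'

  -- The walk is absorbed from its end `t` backwards, skipping vertices already present. Repetitions
  -- are harmless, so walks suffice where paths might be expected.
  grow-walk : ∀ {vs es s t} → Grown vs es → t ∈ vs → Star R s t → Extension vs (s ∈_)
  grow-walk g t∈ ε = _ , _ , g , id , t∈
  grow-walk {s = s} g t∈ (e ◅ w) with grow-walk g t∈ w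
  ... | vs' , es' , g' , inc , u∈ with s ∈? vs'
  ... | yes s∈ = vs' , es' , g' , inc , s∈
  ... | no  s∉ = _ , _ , leaf g' u∈ s∉ e , there ∘ inc , here refl

  grow-walks : ∀ (S : List V) {vs es} → Grown vs es → (∀ s → s ∈ S → Star R s r) →
    Extension vs (λ vs' → ∀ s → s ∈ S → s ∈ vs')
  grow-walks []      g w = _ , _ , g , id , λ _ ()
  grow-walks (s ∷ S) g w with grow-walk g (grown-root∈ g) (w s (here refl))
  ... | _ , _ , g' , inc , s∈ with grow-walks S g' (λ s' → w s' ∘ there)
  ... | vs'' , es'' , g'' , inc' , S⊆ = vs'' , es'' , g'' , inc' ∘ inc ,
    λ { _ (here refl) → inc' s∈ ; s' (there s'∈) → S⊆ s' s'∈ }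

-- Families of edge relations and the trees inside them

record Family {V : Set} (Adj : V → V → Set) (S : V → Set) (m : ℕ) : Set₁ where
  field
    E         : Fin m → V → V → Set
    E-sym     : ∀ {i u v} → E i u v → E i v u
    E-adj     : ∀ {i u v} → E i u v → Adj u v
    E-disj    : ∀ {i j u v} → E i u v → E j u v → i ≡ j
    E-meet    : ∀ {i j u v w} → E i u v → E j u w → i ≡ j ⊎ S u
    hub       : Fin m → V
    reach     : ∀ i {s} → S s → Star (E i) s (hub i)

-- Every tree is rooted at the terminal `x`, so the root, the one vertex that might lie on no edge,
-- is an admissible common vertex. The hub merely splices the walks of two terminals.
family-trees : {V : Set} {Adj : V → V → Set} {m : ℕ} {x : V} {S : List V} →
  DecidableEquality V → Family Adj (_∈ (x ∷ S)) m →
  Σ (Fin m → SubGraph V) (InternallyDisjointSTrees Adj (x ∷ S) m)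
family-trees {V} {Adj} {m} {x} {S} _≟_ fam = T , isTree , disjoint
  where
  open Family fam
  grown : ∀ i → Extension _≟_ (E i) x (x ∷ []) (λ vs → ∀ s → s ∈ (x ∷ S) → s ∈ vs)
  grown i = grow-walks _≟_ (E i) x (x ∷ S) root
    (λ s s∈ → reach i s∈ ◅◅ Star.reverse E-sym (reach i (here refl)))
  T : Fin m → SubGraph V
  T i = subgraph (proj₁ (grown i)) (proj₁ (proj₂ (grown i)))
  g : ∀ i → Grown _≟_ (E i) x (verts (T i)) (edges (T i))
  g i = proj₁ (proj₂ (proj₂ (grown i)))
  isTree : ∀ i → IsTree Adj (T i) × (∀ s → s ∈ (x ∷ S) → s ∈ verts (T i))
  isTree i =
    ( grown-unique _≟_ (E i) x (g i)
    , (λ u v m → let e , u∈v∈ = grown-edge _≟_ (E i) x (g i) m in E-adj e , u∈v∈)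
    , (λ u v u∈ v∈ → grown-toRoot _≟_ (E i) x (g i) u∈ ◅◅
         Star.reverse EdgeIn-sym (grown-toRoot _≟_ (E i) x (g i) v∈))
    , grown-acyclic _≟_ (E i) x (g i) ) ,
    proj₂ (proj₂ (proj₂ (proj₂ (grown i))))
  edgeIn-E : ∀ i {u v} → EdgeIn (edges (T i)) u v → E i u v
  edgeIn-E i (inj₁ m) = proj₁ (grown-edge _≟_ (E i) x (g i) m)
  edgeIn-E i (inj₂ m) = E-sym (proj₁ (grown-edge _≟_ (E i) x (g i) m))
  meet : ∀ i j → i ≢ j → ∀ {v} → v ≡ x ⊎ ∃ (E i v) → v ≡ x ⊎ ∃ (E j v) → v ∈ (x ∷ S)
  meet i j i≢j (inj₁ refl)    _              = here refl
  meet i j i≢j (inj₂ _)       (inj₁ refl)    = here refl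
  meet i j i≢j (inj₂ (_ , e)) (inj₂ (_ , f)) = [ ⊥-elim ∘ i≢j , id ]′ (E-meet e f)
  disjoint : ∀ i j → i ≢ j →
    (∀ u v → EdgeIn (edges (T i)) u v → EdgeIn (edges (T j)) u v → ⊥) ×
    (∀ v → v ∈ verts (T i) → v ∈ verts (T j) → v ∈ (x ∷ S))
  disjoint i j i≢j =
    (λ u v e f → i≢j (E-disj (edgeIn-E i e) (edgeIn-E j f))) ,
    (λ v v∈ v∈' → meet i j i≢j (grown-support _≟_ (E i) x (g i) v∈)
                                (grown-support _≟_ (E j) x (g j) v∈'))

-- The cube and its fans

Q : ℕ → Set
Q = Vec Bool

private variable
  m : ℕ

_≟ᵠ_ : DecidableEquality (Q m)
_≟ᵠ_ = Vec.≡-dec _≟ᵇ_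

flip : Q m → Fin m → Q m
flip q i = updateAt q i not

diff1-flip : (q : Q m) (i : Fin m) → Diff1 q (flip q i)
diff1-flip (x ∷ q) zero    = here (not-¬ refl) refl
diff1-flip (x ∷ q) (suc i) = there (diff1-flip q i)

diff1-sym : {x y : Q m} → Diff1 x y → Diff1 y x
diff1-sym (here ne eq) = here (ne ∘ sym) (sym eq)
diff1-sym (there d)    = there (diff1-sym d)

diff1-irrefl : {x : Q m} → ¬ Diff1 x x
diff1-irrefl (here ne _) = ne refl
diff1-irrefl (there d)   = diff1-irrefl d

diff1-≢ : {x y : Q m} → Diff1 x y → x ≢ y
diff1-≢ d refl = diff1-irrefl d

flip-≢ : (q : Q m) (i : Fin m) → flip q i ≢ q
flip-≢ q i = diff1-≢ (diff1-sym (diff1-flip q i))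

flip-injective : (q : Q m) {i j : Fin m} → flip q i ≡ flip q j → i ≡ j
flip-injective (x ∷ q) {zero}  {zero}  _  = refl
flip-injective (x ∷ q) {zero}  {suc j} eq = ⊥-elim (not-¬ refl (sym (∷-injectiveˡ eq)))
flip-injective (x ∷ q) {suc i} {zero}  eq = ⊥-elim (not-¬ refl (∷-injectiveˡ eq))
flip-injective (x ∷ q) {suc i} {suc j} eq = cong suc (flip-injective q (∷-injectiveʳ eq))

flip-involutive : (q : Q m) (i : Fin m) → flip (flip q i) i ≡ q
flip-involutive q i =
  trans (updateAt-updateAt-local i q (not-involutive _)) (updateAt-id i q)

cube-connected : (x y : Q m) → Star Diff1 x y
cube-connected []      []      = ε
cube-connected (a ∷ x) (b ∷ y) with a ≟ᵇ b
... | yes refl = Star.gmap (a ∷_) there (cube-connected x y)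
... | no  a≢b  = here a≢b refl ◅ Star.gmap (b ∷_) there (cube-connected x y)

differ-at : {x y : Q m} → x ≢ y → ∃ λ k → lookup x k ≢ lookup y k
differ-at {x = []}    {[]}    ne = ⊥-elim (ne refl)
differ-at {x = a ∷ x} {b ∷ y} ne with a ≟ᵇ b
... | no  a≢b  = zero , a≢b
... | yes refl with differ-at (ne ∘ cong (a ∷_))
... | k , ne'  = suc k , ne'

flip-reaches : (x : Q m) {y : Q m} {i k : Fin m} → lookup x k ≢ lookup y k → flip x i ≡ y → i ≡ k
flip-reaches x {i = i} {k} ne refl with i ≟ᶠ k
... | yes i≡k = i≡k
... | no  i≢k = ⊥-elim (ne (sym (lookup∘updateAt′ k i (i≢k ∘ sym) x)))

Ind : (Q m → Set) → Q m → Q m → Set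
Ind U x y = U x × U y × Diff1 x y

ind-sym : {U : Q m → Set} {x y : Q m} → Ind U x y → Ind U y x
ind-sym (ux , uy , d) = uy , ux , diff1-sym d

ind-end : {U : Q m → Set} {x y : Q m} → U x → Star (Ind U) x y → U y
ind-end u ε                 = u
ind-end _ ((_ , v , _) ◅ w) = ind-end v w

-- m walks from the neighbours of q to t, the i-th one inside U i, which together with q
-- form internally disjoint walks from q to t (a single edge each when q ≡ t).
record Fan {m} (q t : Q m) : Set₁ where
  field
    U      : Fin m → Q m → Set
    U-meet : ∀ {i j x} → U i x → U j x → i ≡ j ⊎ x ≡ t
    avoids : ∀ {i} → U i q → q ≡ t
    starts : ∀ i → U i (flip q i)
    walk   : ∀ i → Star (Ind (U i)) (flip q i) t

-- The new direction crosses to the other layer at once, walks there freely and comes back only at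
-- `t`; the old walks stay in layer `h`.
fan-parallel : {q t : Q m} (h : Bool) → Fan q t → Fan (h ∷ q) (h ∷ t)
fan-parallel {m} {q} {t} h fan = record
  { U = U⁺ ; U-meet = λ {i} {j} → meet i j ; avoids = λ {i} → avoid i ; starts = start ; walk = walk⁺ }
  where
  open Fan fan
  U⁺ : Fin (suc m) → Q (suc m) → Set
  U⁺ zero    (k ∷ x) = k ≡ not h ⊎ (k ≡ h × x ≡ t)
  U⁺ (suc i) (k ∷ x) = k ≡ h × U i x
  meet : ∀ i j {x} → U⁺ i x → U⁺ j x → i ≡ j ⊎ x ≡ h ∷ t
  meet zero    zero    _ _ = inj₁ refl
  meet zero    (suc j) {_ ∷ _} (inj₁ refl)          (eq , _)   = ⊥-elim (not-¬ refl (sym eq))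
  meet zero    (suc j) {_ ∷ _} (inj₂ (refl , refl)) _          = inj₂ refl
  meet (suc i) zero    {_ ∷ _} (eq , _)   (inj₁ refl)          = ⊥-elim (not-¬ refl (sym eq))
  meet (suc i) zero    {_ ∷ _} _          (inj₂ (refl , refl)) = inj₂ refl
  meet (suc i) (suc j) {_ ∷ _} (refl , u) (_ , u') = Sum.map (cong suc) (cong (h ∷_)) (U-meet u u')
  avoid : ∀ i → U⁺ i (h ∷ q) → h ∷ q ≡ h ∷ t
  avoid zero    (inj₁ eq)         = ⊥-elim (not-¬ refl eq)
  avoid zero    (inj₂ (_ , refl)) = refl
  avoid (suc i) (_ , u)           = cong (h ∷_) (avoids u)
  start : ∀ i → U⁺ i (flip (h ∷ q) i)
  start zero    = inj₁ refl
  start (suc i) = refl , starts i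
  walk⁺ : ∀ i → Star (Ind (U⁺ i)) (flip (h ∷ q) i) (h ∷ t)
  walk⁺ zero =
    Star.gmap (not h ∷_) (λ d → inj₁ refl , inj₁ refl , there d) (cube-connected q t) ◅◅
    (inj₁ refl , inj₂ (refl , refl) , here (not-¬ refl ∘ sym) refl) ◅ ε
  walk⁺ (suc i) = Star.gmap (h ∷_) (λ (u , v , d) → (refl , u) , (refl , v) , there d) (walk i)

-- D i singles out the direction whose walk is the one followed, in the layer of t, by the
-- walk through flip (h ∷ q) zero; the walk numbered suc i then stays in the layer of q until
-- its last step, and all other walks change layer at once.
fan-across : {q t : Q m} (h : Bool) → Fan q t → (D : Fin m → Set) → (∀ i → Dec (D i)) →
  (∀ {i j} → D i → D j → i ≡ j) → (∀ {i j} → D j → flip q i ≡ t → i ≡ j) →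
  (∀ {i} → D i → q ≢ t) → (q ≡ t ⊎ ∃ D) → Fan (h ∷ q) (not h ∷ t)
fan-across {m} {q} {t} h fan D D? D-unique D-last D-≢ choice = record
  { U = U⁺ ; U-meet = meet _ _ ; avoids = λ {i} u → ⊥-elim (avoid i u) ; starts = start ; walk = walk⁺ }
  where
  open Fan fan
  U⁺ : Fin (suc m) → Q (suc m) → Set
  U⁺ zero    (k ∷ x) = k ≡ not h × (x ≡ q ⊎ ∃ λ i → D i × U i x)
  U⁺ (suc i) (k ∷ x) = (k ≡ not h × (x ≡ t ⊎ (¬ D i × U i x))) ⊎
                       (k ≡ h × (x ≡ flip q i ⊎ (D i × U i x)))
  meet₀ : ∀ {j k x} → U⁺ zero (k ∷ x) → U⁺ (suc j) (k ∷ x) → k ∷ x ≡ not h ∷ t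
  meet₀ (refl , inj₁ refl)        (inj₁ (_ , inj₁ refl))    = refl
  meet₀ (refl , inj₁ refl)        (inj₁ (_ , inj₂ (_ , u))) = cong (not h ∷_) (avoids u)
  meet₀ (refl , inj₂ _)           (inj₁ (_ , inj₁ refl))    = refl
  meet₀ (refl , inj₂ (i , d , u)) (inj₁ (_ , inj₂ (¬d , u'))) with U-meet u u'
  ... | inj₁ refl = ⊥-elim (¬d d)
  ... | inj₂ refl = refl
  meet₀ (refl , _) (inj₂ (eq , _)) = ⊥-elim (not-¬ refl (sym eq))
  meet : ∀ i j {x} → U⁺ i x → U⁺ j x → i ≡ j ⊎ x ≡ not h ∷ t
  meet zero    zero    _ _ = inj₁ refl
  meet zero    (suc j) {_ ∷ _} u u' = inj₂ (meet₀ u u')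
  meet (suc i) zero    {_ ∷ _} u u' = inj₂ (meet₀ u' u)
  meet (suc i) (suc j) {_ ∷ _} (inj₁ (refl , inj₁ refl)) _ = inj₂ refl
  meet (suc i) (suc j) {_ ∷ _} _ (inj₁ (refl , inj₁ refl)) = inj₂ refl
  meet (suc i) (suc j) {_ ∷ _} (inj₁ (refl , inj₂ (_ , u))) (inj₁ (_ , inj₂ (_ , u'))) =
    Sum.map (cong suc) (cong (not h ∷_)) (U-meet u u')
  meet (suc i) (suc j) {_ ∷ _} (inj₁ (refl , _)) (inj₂ (eq , _)) = ⊥-elim (not-¬ refl (sym eq))
  meet (suc i) (suc j) {_ ∷ _} (inj₂ (eq , _)) (inj₁ (refl , _)) = ⊥-elim (not-¬ refl (sym eq))
  meet (suc i) (suc j) {_ ∷ _} (inj₂ (_ , inj₁ refl)) (inj₂ (_ , inj₁ eq)) =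
    inj₁ (cong suc (flip-injective q eq))
  meet (suc i) (suc j) {_ ∷ _} (inj₂ (_ , inj₁ refl)) (inj₂ (_ , inj₂ (d , u))) =
    inj₁ (cong suc ([ id , D-last d ]′ (U-meet (starts i) u)))
  meet (suc i) (suc j) {_ ∷ _} (inj₂ (_ , inj₂ (d , u))) (inj₂ (_ , inj₁ refl)) =
    inj₁ (cong suc (sym ([ id , D-last d ]′ (U-meet (starts j) u))))
  meet (suc i) (suc j) {_ ∷ _} (inj₂ (_ , inj₂ (d , _))) (inj₂ (_ , inj₂ (d' , _))) =
    inj₁ (cong suc (D-unique d d'))
  avoid : ∀ i → ¬ U⁺ i (h ∷ q)
  avoid zero    (eq , _)                  = not-¬ refl eq
  avoid (suc i) (inj₁ (eq , _))           = not-¬ refl eq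
  avoid (suc i) (inj₂ (_ , inj₁ eq))      = flip-≢ q i (sym eq)
  avoid (suc i) (inj₂ (_ , inj₂ (d , u))) = D-≢ d (avoids u)
  start : ∀ i → U⁺ i (flip (h ∷ q) i)
  start zero    = refl , inj₁ refl
  start (suc i) = inj₂ (refl , inj₁ refl)
  walk⁺ : ∀ i → Star (Ind (U⁺ i)) (flip (h ∷ q) i) (not h ∷ t)
  walk⁺ zero = [ (λ { refl → ε }) , detour ]′ choice
    where
    detour : ∃ D → Star (Ind (U⁺ zero)) (not h ∷ q) (not h ∷ t)
    detour (i , d) =
      ((refl , inj₁ refl) , (refl , inj₂ (i , d , starts i)) , there (diff1-flip q i)) ◅
      Star.gmap (not h ∷_)
        (λ (u , v , e) → (refl , inj₂ (i , d , u)) , (refl , inj₂ (i , d , v)) , there e) (walk i)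
  walk⁺ (suc i) with D? i
  ... | yes d =
    Star.gmap (h ∷_)
      (λ (u , v , e) → inj₂ (refl , inj₂ (d , u)) , inj₂ (refl , inj₂ (d , v)) , there e) (walk i) ◅◅
    (inj₂ (refl , inj₂ (d , ind-end (starts i) (walk i))) , inj₁ (refl , inj₁ refl) ,
      here (not-¬ refl) refl) ◅ ε
  ... | no ¬d =
    (inj₂ (refl , inj₁ refl) , inj₁ (refl , inj₂ (¬d , starts i)) , here (not-¬ refl) refl) ◅
    Star.gmap (not h ∷_)
      (λ (u , v , e) → inj₁ (refl , inj₂ (¬d , u)) , inj₁ (refl , inj₂ (¬d , v)) , there e) (walk i)

fan : (q t : Q m) → Fan q t
fan []      []       = record
  { U = λ () ; U-meet = λ { {()} } ; avoids = λ { {()} } ; starts = λ () ; walk = λ () }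
fan (h ∷ q) (h' ∷ t) with h' ≟ᵇ h
... | yes refl = fan-parallel h (fan q t)
... | no  h'≢h with ¬-not h'≢h | q ≟ᵠ t
...   | refl | yes q≡t = fan-across h (fan q t) (λ _ → ⊥) (λ _ → no id)
                           (λ ()) (λ ()) (λ ()) (inj₁ q≡t)
...   | refl | no q≢t with differ-at q≢t
-- If `t` is itself a neighbour `flip q i`, then `i ≡ k`. This matters because the walk `suc k`
-- visits `h ∷ t` before it changes layer, and no other walk may start there.
...     | k , ne = fan-across h (fan q t) (_≡ k) (_≟ᶠ k)
                     (λ { refl refl → refl }) (λ { refl → flip-reaches q ne })
                     (λ _ → q≢t) (inj₂ (k , refl))

-- Disjoint pieces inside one cluster

-- The part of the m trees that lies in one cluster with terminals P; the i-th tree leaves the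
-- cluster only at the positions C i.
record Net {m} (P : Q m → Set) : Set₁ where
  field
    F      : Fin m → Q m → Q m → Set
    U      : Fin m → Q m → Set
    F-sym  : ∀ {i x y} → F i x y → F i y x
    F-adj  : ∀ {i x y} → F i x y → Diff1 x y
    F-in   : ∀ {i x y} → F i x y → U i x
    F-disj : ∀ {i j x y} → F i x y → F j x y → i ≡ j
    U-meet : ∀ {i j x} → U i x → U j x → i ≡ j ⊎ P x

-- `reach` promises each terminal some exit in `C i`, not a common one: a piece may fall apart
-- inside the cluster, provided that its parts meet again outside. The net is kept apart because
-- `Split` equips one net with two families of exits.
record Side {m} (P : Q m → Set) (C : Fin m → Q m → Set) : Set₁ where
  field
    net    : Net P
  open Net net public
  field
    C-disj : ∀ {i j x} → C i x → C j x → i ≡ j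
    C-in   : ∀ {i x} → C i x → U i x
    reach  : ∀ i {p} → P p → ∃ λ c → C i c × Star (F i) p c

side-resp : {P P' : Q m → Set} {C : Fin m → Q m → Set} →
  (∀ {x} → P x → P' x) → (∀ {x} → P' x → P x) → Side P C → Side P' C
side-resp to from s = record
  { net = record
    { F = F ; U = U ; F-sym = F-sym ; F-adj = F-adj ; F-in = F-in ; F-disj = F-disj
    ; U-meet = λ u v → Sum.map₂ to (U-meet u v) }
  ; C-disj = C-disj ; C-in = C-in ; reach = λ i → reach i ∘ from }
  where open Side s

side-relabel : {P : Q m → Set} {C : Fin m → Q m → Set} (σ : Fin m → Fin m) →
  (∀ {i j} → σ i ≡ σ j → i ≡ j) → Side P C → Side P (C ∘ σ)
side-relabel σ inj s = record
  { net = record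
    { F = F ∘ σ ; U = U ∘ σ ; F-sym = F-sym ; F-adj = F-adj ; F-in = F-in
    ; F-disj = λ e e' → inj (F-disj e e')
    ; U-meet = λ u v → Sum.map₁ inj (U-meet u v) }
  ; C-disj = λ c c' → inj (C-disj c c') ; C-in = C-in ; reach = reach ∘ σ }
  where open Side s

Spoke : Q m → Fin m → Q m → Q m → Set
Spoke q i x y = (x ≡ q × y ≡ flip q i) ⊎ (x ≡ flip q i × y ≡ q)

spoke-disj : (q : Q m) {i j : Fin m} {x y : Q m} → Spoke q i x y → Spoke q j x y → i ≡ j
spoke-disj q (inj₁ (refl , refl)) (inj₁ (_ , eq)) = flip-injective q eq
spoke-disj q (inj₁ (refl , refl)) (inj₂ (eq , _)) = ⊥-elim (flip-≢ q _ (sym eq))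
spoke-disj q (inj₂ (refl , refl)) (inj₁ (eq , _)) = ⊥-elim (flip-≢ q _ eq)
spoke-disj q (inj₂ (refl , refl)) (inj₂ (eq , _)) = flip-injective q eq

spoke-sym : {q : Q m} {i : Fin m} {x y : Q m} → Spoke q i x y → Spoke q i y x
spoke-sym (inj₁ (e , e')) = inj₂ (e' , e)
spoke-sym (inj₂ (e , e')) = inj₁ (e' , e)

spoke-adj : (q : Q m) {i : Fin m} {x y : Q m} → Spoke q i x y → Diff1 x y
spoke-adj q (inj₁ (refl , refl)) = diff1-flip q _
spoke-adj q (inj₂ (refl , refl)) = diff1-sym (diff1-flip q _)

-- `D` selects the trees that also use the edge from `q` to the start of their walk. All of them may
-- do so when `q` is a terminal, otherwise only one, since `q` then belongs to a single tree.
fan-net : (q t : Q m) {P : Q m → Set} (D : Fin m → Set) → P t →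
  (∀ {i j} → D i → D j → i ≡ j ⊎ P q) → Net P
fan-net {m} q t {P} D Pt D-meet = record
  { F = F ; U = U⁺
  ; F-sym = λ { (inj₁ e) → inj₁ (ind-sym e) ; (inj₂ (d , e)) → inj₂ (d , spoke-sym e) }
  ; F-adj = λ { (inj₁ (_ , _ , e)) → e ; (inj₂ (_ , e)) → spoke-adj q e }
  ; F-in = F-in ; F-disj = F-disj ; U-meet = meet }
  where
  open Fan (fan q t)
  F : Fin m → Q m → Q m → Set
  F i x y = Ind (U i) x y ⊎ (D i × Spoke q i x y)
  U⁺ : Fin m → Q m → Set
  U⁺ i x = U i x ⊎ (D i × x ≡ q)
  F-in : ∀ {i x y} → F i x y → U⁺ i x
  F-in (inj₁ (u , _))                  = inj₁ u
  F-in (inj₂ (d , inj₁ (refl , _)))    = inj₂ (d , refl)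
  F-in (inj₂ (d , inj₂ (refl , refl))) = inj₁ (starts _)
  -- A fan meets `q` only if `q ≡ t`. Then `flip q j` differs from `t` and, being a start of the
  -- walk `j`, lies in no other `U i`. So no edge of a walk is a spoke of another tree.
  tip : ∀ {i j} → U i q → U i (flip q j) → i ≡ j
  tip {j = j} u v with U-meet v (starts j)
  ... | inj₁ i≡j = i≡j
  ... | inj₂ eq  = ⊥-elim (flip-≢ q j (trans eq (sym (avoids u))))
  ind-spoke : ∀ {i j x y} → Ind (U i) x y → Spoke q j x y → i ≡ j
  ind-spoke (u , v , _) (inj₁ (refl , refl)) = tip u v
  ind-spoke (u , v , _) (inj₂ (refl , refl)) = tip v u
  F-disj : ∀ {i j x y} → F i x y → F j x y → i ≡ j
  F-disj (inj₁ (u , v , e)) (inj₁ (u' , v' , _)) with U-meet u u' | U-meet v v'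
  ... | inj₁ i≡j  | _         = i≡j
  ... | inj₂ _    | inj₁ i≡j  = i≡j
  ... | inj₂ refl | inj₂ refl = ⊥-elim (diff1-irrefl e)
  F-disj (inj₁ e) (inj₂ (_ , e')) = ind-spoke e e'
  F-disj (inj₂ (_ , e)) (inj₁ e') = sym (ind-spoke e' e)
  F-disj (inj₂ (_ , e)) (inj₂ (_ , e')) = spoke-disj q e e'
  meet : ∀ {i j x} → U⁺ i x → U⁺ j x → i ≡ j ⊎ P x
  meet (inj₁ u) (inj₁ v)                = Sum.map₂ (λ { refl → Pt }) (U-meet u v)
  meet (inj₁ u) (inj₂ (_ , refl))       = inj₂ (subst P (sym (avoids u)) Pt)
  meet (inj₂ (_ , refl)) (inj₁ v)       = inj₂ (subst P (sym (avoids v)) Pt)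
  meet (inj₂ (d , refl)) (inj₂ (d' , _)) = D-meet d d'

fan-side : (q t : Q m) {P : Q m → Set} (D : Fin m → Set) → P t →
  (∀ {i j} → D i → D j → i ≡ j ⊎ P q) →
  (∀ {s} → P s → s ≡ t ⊎ (s ≡ q × ∀ i → D i)) → Side P (λ i x → x ≡ flip q i)
fan-side q t {P} D Pt D-meet P-only = record
  { net = net
  ; C-disj = λ { refl eq → flip-injective q eq }
  ; C-in = λ { refl → inj₁ (starts _) }
  ; reach = λ i Pp → flip q i , refl , to i (P-only Pp) }
  where
  open Fan (fan q t)
  net : Net P
  net = fan-net q t D Pt D-meet
  to : ∀ i {s} → s ≡ t ⊎ (s ≡ q × (∀ i → D i)) → Star (Net.F net i) s (flip q i)
  to i (inj₁ refl)       = Star.reverse (Net.F-sym net) (Star.map inj₁ (walk i))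
  to i (inj₂ (refl , D)) = inj₂ (D i , inj₁ (refl , refl)) ◅ ε

Pair : Q m → Q m → Q m → Set
Pair p q x = x ≡ p ⊎ x ≡ q

pair-side : (p q : Q m) → Side (Pair p q) (λ i x → x ≡ flip p i)
pair-side p q = fan-side p q (λ _ → ⊤) (inj₂ refl) (λ _ _ → inj₂ (inj₁ refl))
  λ { (inj₁ eq) → inj₂ (eq , λ _ → tt) ; (inj₂ eq) → inj₁ eq }

single-side : (q t : Q m) → Side (_≡ t) (λ i x → x ≡ flip q i)
single-side q t = fan-side q t (λ _ → ⊥) refl (λ ()) inj₁

-- For clusters of opposite classes, `a` is the position whose cross edge leads to the other
-- terminal cluster. At most one exit `flip p i` equals it; that exit moves to `p`, which is not a
-- neighbour of itself and hence not yet an exit.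
avoiding : Q m → Q m → Fin m → Q m
avoiding p a i with flip p i ≟ᵠ a
... | yes _ = p
... | no  _ = flip p i

avoiding-cases : (p a : Q m) (i : Fin m) →
  (flip p i ≡ a × avoiding p a i ≡ p) ⊎ (flip p i ≢ a × avoiding p a i ≡ flip p i)
avoiding-cases p a i with flip p i ≟ᵠ a
... | yes eq = inj₁ (eq , refl)
... | no  ne = inj₂ (ne , refl)

avoiding-≢ : (p a : Q m) (i : Fin m) → avoiding p a i ≢ a
avoiding-≢ p a i eq with avoiding-cases p a i
... | inj₁ (eq' , eq'') = flip-≢ p i (trans eq' (trans (sym eq) eq''))
... | inj₂ (ne , eq')   = ne (trans (sym eq') eq)

avoiding-injective : (p a : Q m) {i j : Fin m} → avoiding p a i ≡ avoiding p a j → i ≡ j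
avoiding-injective p a {i} {j} eq with avoiding-cases p a i | avoiding-cases p a j
... | inj₁ (e , _) | inj₁ (e' , _) = flip-injective p (trans e (sym e'))
... | inj₁ (_ , e) | inj₂ (_ , e') = ⊥-elim (flip-≢ p j (trans (sym e') (trans (sym eq) e)))
... | inj₂ (_ , e) | inj₁ (_ , e') = ⊥-elim (flip-≢ p i (trans (sym e) (trans eq e')))
... | inj₂ (_ , e) | inj₂ (_ , e') = flip-injective p (trans (sym e) (trans eq e'))

pair-side-avoiding : (p q a : Q m) → Side (Pair p q) (λ i x → x ≡ avoiding p a i)
pair-side-avoiding {m} p q a = record
  { net = net
  ; C-disj = λ { refl eq → avoiding-injective p a eq }
  ; C-in = C-in⁺
  ; reach = reach⁺ }
  where
  open Side (pair-side p q)
  C-in⁺ : ∀ {i x} → x ≡ avoiding p a i → U i x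
  C-in⁺ {i} eq with avoiding-cases p a i
  ... | inj₁ (_ , eq') = inj₂ (tt , trans eq eq')
  ... | inj₂ (_ , eq') = C-in (trans eq eq')
  reach⁺ : ∀ i {s} → Pair p q s → ∃ λ c → c ≡ avoiding p a i × Star (F i) s c
  reach⁺ i Ps with reach i Ps | avoiding-cases p a i
  ... | _ , refl , w | inj₁ (_ , eq) = p , sym eq , w ◅◅ (inj₂ (tt , inj₂ (refl , refl)) ◅ ε)
  ... | _ , refl , w | inj₂ (_ , eq) = flip p i , sym eq , w

-- Three terminals in one cluster

Triple : Q m → Q m → Q m → Q m → Set
Triple p q r x = x ≡ p ⊎ x ≡ q ⊎ x ≡ r

-- A fan that starts at `centre` in a second cluster of the same class leaves at `flip centre i`. As
-- this position lies in `C i` and the sets are disjoint, only exits of equal index lead into a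
-- common cluster of the other class.
record CentredSide {m} (P : Q m → Set) : Set₁ where
  field
    C        : Fin m → Q m → Set
    side     : Side P C
    centre   : Q m
    centre-C : ∀ i → C i (flip centre i)

-- The additional tree lives in the layer opposite to the terminals.
centredSide-cons : (h : Bool) {P : Q m → Set} {P⁺ : Q (suc m) → Set} →
  (∀ {x} → P x → P⁺ (h ∷ x)) → (∀ {k x} → P⁺ (k ∷ x) → k ≡ h × P x) →
  CentredSide P → CentredSide P⁺
centredSide-cons {m} h {P} {P⁺} to from cs = record
  { C = C⁺
  ; side = record
    { net = record
      { F = F⁺ ; U = U⁺ ; F-sym = λ {i} → F⁺-sym i ; F-adj = λ {i} → F⁺-adj i
      ; F-in = λ {i} → F⁺-in i ; F-disj = λ {i} {j} → F⁺-disj i j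
      ; U-meet = λ {i} {j} → U⁺-meet i j }
    ; C-disj = λ {i} {j} → C⁺-disj i j
    ; C-in = λ {i} → C⁺-in i
    ; reach = reach⁺ }
  ; centre = h ∷ centre
  ; centre-C = λ { zero → refl , refl ; (suc i) → refl , centre-C i } }
  where
  open CentredSide cs
  open Side side
  F⁺ : Fin (suc m) → Q (suc m) → Q (suc m) → Set
  F⁺ zero    (k ∷ x) (l ∷ y) = (k ≡ not h × l ≡ not h × Diff1 x y) ⊎ (k ≢ l × x ≡ y × P x)
  F⁺ (suc i) (k ∷ x) (l ∷ y) = k ≡ h × l ≡ h × F i x y
  U⁺ : Fin (suc m) → Q (suc m) → Set
  U⁺ zero    (k ∷ x) = k ≡ not h ⊎ (k ≡ h × P x)
  U⁺ (suc i) (k ∷ x) = k ≡ h × U i x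
  C⁺ : Fin (suc m) → Q (suc m) → Set
  C⁺ zero    (k ∷ x) = k ≡ not h × x ≡ centre
  C⁺ (suc i) (k ∷ x) = k ≡ h × C i x
  F⁺-sym : ∀ i {x y} → F⁺ i x y → F⁺ i y x
  F⁺-sym zero {_ ∷ _} {_ ∷ _} (inj₁ (eq , eq' , d))   = inj₁ (eq' , eq , diff1-sym d)
  F⁺-sym zero {_ ∷ _} {_ ∷ _} (inj₂ (ne , refl , Px)) = inj₂ (ne ∘ sym , refl , Px)
  F⁺-sym (suc i) {_ ∷ _} {_ ∷ _} (eq , eq' , e)       = eq' , eq , F-sym e
  F⁺-adj : ∀ i {x y} → F⁺ i x y → Diff1 x y
  F⁺-adj zero {_ ∷ _} {_ ∷ _} (inj₁ (refl , refl , d)) = there d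
  F⁺-adj zero {_ ∷ _} {_ ∷ _} (inj₂ (ne , eq , _))     = here ne eq
  F⁺-adj (suc i) {_ ∷ _} {_ ∷ _} (refl , refl , e)     = there (F-adj e)
  F⁺-in : ∀ i {x y} → F⁺ i x y → U⁺ i x
  F⁺-in zero {_ ∷ _} {_ ∷ _} (inj₁ (eq , _)) = inj₁ eq
  F⁺-in zero {k ∷ _} {_ ∷ _} (inj₂ (_ , refl , Px)) with k ≟ᵇ h
  ... | yes k≡h = inj₂ (k≡h , Px)
  ... | no  k≢h = inj₁ (¬-not k≢h)
  F⁺-in (suc i) {_ ∷ _} {_ ∷ _} (eq , _ , e) = eq , F-in e
  F⁺-disj₀ : ∀ j {x y} → F⁺ zero x y → F⁺ (suc j) x y → ⊥
  F⁺-disj₀ j {_ ∷ _} {_ ∷ _} (inj₁ (refl , _)) (eq , _)     = not-¬ refl (sym eq)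
  F⁺-disj₀ j {_ ∷ _} {_ ∷ _} (inj₂ (ne , _)) (eq , eq' , _) = ne (trans eq (sym eq'))
  F⁺-disj : ∀ i j {x y} → F⁺ i x y → F⁺ j x y → i ≡ j
  F⁺-disj zero zero _ _ = refl
  F⁺-disj zero (suc j) e e' = ⊥-elim (F⁺-disj₀ j e e')
  F⁺-disj (suc i) zero e e' = ⊥-elim (F⁺-disj₀ i e' e)
  F⁺-disj (suc i) (suc j) {_ ∷ _} {_ ∷ _} (_ , _ , e) (_ , _ , e') = cong suc (F-disj e e')
  U⁺-meet₀ : ∀ j {x} → U⁺ zero x → U⁺ (suc j) x → P⁺ x
  U⁺-meet₀ j {_ ∷ _} (inj₁ refl) (eq , _)    = ⊥-elim (not-¬ refl (sym eq))
  U⁺-meet₀ j {_ ∷ _} (inj₂ (refl , Px)) _    = to Px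
  U⁺-meet : ∀ i j {x} → U⁺ i x → U⁺ j x → i ≡ j ⊎ P⁺ x
  U⁺-meet zero zero _ _ = inj₁ refl
  U⁺-meet zero (suc j) u v = inj₂ (U⁺-meet₀ j u v)
  U⁺-meet (suc i) zero u v = inj₂ (U⁺-meet₀ i v u)
  U⁺-meet (suc i) (suc j) {_ ∷ _} (refl , u) (_ , v) = Sum.map (cong suc) to (U-meet u v)
  C⁺-disj : ∀ i j {x} → C⁺ i x → C⁺ j x → i ≡ j
  C⁺-disj zero zero _ _ = refl
  C⁺-disj zero (suc j) {_ ∷ _} (refl , _) (eq , _) = ⊥-elim (not-¬ refl (sym eq))
  C⁺-disj (suc i) zero {_ ∷ _} (eq , _) (refl , _) = ⊥-elim (not-¬ refl (sym eq))
  C⁺-disj (suc i) (suc j) {_ ∷ _} (_ , c) (_ , c') = cong suc (C-disj c c')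
  C⁺-in : ∀ i {x} → C⁺ i x → U⁺ i x
  C⁺-in zero    {_ ∷ _} (eq , _) = inj₁ eq
  C⁺-in (suc i) {_ ∷ _} (eq , c) = eq , C-in c
  reach⁺ : ∀ i {p} → P⁺ p → ∃ λ c → C⁺ i c × Star (F⁺ i) p c
  reach⁺ zero {_ ∷ x} p with from p
  ... | refl , Px = not h ∷ centre , (refl , refl) ,
    inj₂ (not-¬ refl , refl , Px) ◅
    Star.gmap (not h ∷_) (λ d → inj₁ (refl , refl , d)) (cube-connected x centre)
  reach⁺ (suc i) {_ ∷ x} p with from p
  ... | refl , Px with reach i Px
  ... | c , Cc , w = h ∷ c , (refl , Cc) , Star.gmap (h ∷_) (λ e → refl , refl , e) w

-- Terminals p and q in layer h, r in the other layer: the tree suc j consists of the j-th walk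
-- from p to q, the edge between the layers at flip p j and the j-th walk from there to r.
module Split {m} (h : Bool) (p q r : Q m) where

  open Side (pair-side p q)
  open Fan (fan p r) using () renaming (U to W; U-meet to W-meet; avoids to W-avoids; starts to W-starts; walk to W-walk)

  P⁺ : Q (suc m) → Set
  P⁺ = Triple (h ∷ p) (h ∷ q) (not h ∷ r)

  F⁺ : Fin (suc m) → Q (suc m) → Q (suc m) → Set
  F⁺ zero    (k ∷ x) (l ∷ y) = k ≢ l × x ≡ y × x ≡ p
  F⁺ (suc j) (k ∷ x) (l ∷ y) = (k ≡ h × l ≡ h × F j x y) ⊎
                               (k ≡ not h × l ≡ not h × Ind (W j) x y) ⊎
                               (k ≢ l × x ≡ y × x ≡ flip p j)

  U⁺ : Fin (suc m) → Q (suc m) → Set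
  U⁺ zero    (k ∷ x) = x ≡ p ⊎ P⁺ (k ∷ x)
  U⁺ (suc j) (k ∷ x) = (k ≡ h × U j x) ⊎ (k ≡ not h × W j x)

  F⁺-sym : ∀ i {x y} → F⁺ i x y → F⁺ i y x
  F⁺-sym zero {_ ∷ _} {_ ∷ _} (ne , refl , eq) = ne ∘ sym , refl , eq
  F⁺-sym (suc j) {_ ∷ _} {_ ∷ _} (inj₁ (eq , eq' , e)) = inj₁ (eq' , eq , F-sym e)
  F⁺-sym (suc j) {_ ∷ _} {_ ∷ _} (inj₂ (inj₁ (eq , eq' , e))) = inj₂ (inj₁ (eq' , eq , ind-sym e))
  F⁺-sym (suc j) {_ ∷ _} {_ ∷ _} (inj₂ (inj₂ (ne , refl , eq))) =
    inj₂ (inj₂ (ne ∘ sym , refl , eq))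

  F⁺-adj : ∀ i {x y} → F⁺ i x y → Diff1 x y
  F⁺-adj zero {_ ∷ _} {_ ∷ _} (ne , eq , _) = here ne eq
  F⁺-adj (suc j) {_ ∷ _} {_ ∷ _} (inj₁ (refl , refl , e)) = there (F-adj e)
  F⁺-adj (suc j) {_ ∷ _} {_ ∷ _} (inj₂ (inj₁ (refl , refl , _ , _ , d))) = there d
  F⁺-adj (suc j) {_ ∷ _} {_ ∷ _} (inj₂ (inj₂ (ne , eq , _))) = here ne eq

  F⁺-in : ∀ i {x y} → F⁺ i x y → U⁺ i x
  F⁺-in zero {_ ∷ _} {_ ∷ _} (_ , _ , eq) = inj₁ eq
  F⁺-in (suc j) {_ ∷ _} {_ ∷ _} (inj₁ (eq , _ , e)) = inj₁ (eq , F-in e)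
  F⁺-in (suc j) {_ ∷ _} {_ ∷ _} (inj₂ (inj₁ (eq , _ , w , _))) = inj₂ (eq , w)
  F⁺-in (suc j) {k ∷ _} {_ ∷ _} (inj₂ (inj₂ (_ , _ , refl))) with k ≟ᵇ h
  ... | yes k≡h = inj₁ (k≡h , C-in refl)
  ... | no  k≢h = inj₂ (¬-not k≢h , W-starts j)

  F⁺-disj₀ : ∀ j {x y} → F⁺ zero x y → F⁺ (suc j) x y → ⊥
  F⁺-disj₀ j {_ ∷ _} {_ ∷ _} (ne , _) (inj₁ (eq , eq' , _)) = ne (trans eq (sym eq'))
  F⁺-disj₀ j {_ ∷ _} {_ ∷ _} (ne , _) (inj₂ (inj₁ (eq , eq' , _))) = ne (trans eq (sym eq'))
  F⁺-disj₀ j {_ ∷ _} {_ ∷ _} (_ , _ , refl) (inj₂ (inj₂ (_ , _ , eq))) = flip-≢ p j (sym eq)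

  F⁺-disj : ∀ i j {x y} → F⁺ i x y → F⁺ j x y → i ≡ j
  F⁺-disj zero zero _ _ = refl
  F⁺-disj zero (suc j) e e' = ⊥-elim (F⁺-disj₀ j e e')
  F⁺-disj (suc i) zero e e' = ⊥-elim (F⁺-disj₀ i e' e)
  F⁺-disj (suc i) (suc j) {_ ∷ _} {_ ∷ _} (inj₁ (_ , _ , e)) (inj₁ (_ , _ , e')) =
    cong suc (F-disj e e')
  F⁺-disj (suc i) (suc j) {_ ∷ _} {_ ∷ _} (inj₁ (refl , _)) (inj₂ (inj₁ (eq , _))) =
    ⊥-elim (not-¬ refl eq)
  F⁺-disj (suc i) (suc j) {_ ∷ _} {_ ∷ _} (inj₁ (eq , eq' , _)) (inj₂ (inj₂ (ne , _))) =
    ⊥-elim (ne (trans eq (sym eq')))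
  F⁺-disj (suc i) (suc j) {_ ∷ _} {_ ∷ _} (inj₂ (inj₁ (eq , _))) (inj₁ (refl , _)) =
    ⊥-elim (not-¬ refl eq)
  F⁺-disj (suc i) (suc j) {_ ∷ _} {_ ∷ _}
    (inj₂ (inj₁ (_ , _ , u , v , d))) (inj₂ (inj₁ (_ , _ , u' , v' , _)))
    with W-meet u u' | W-meet v v'
  ... | inj₁ i≡j  | _         = cong suc i≡j
  ... | inj₂ _    | inj₁ i≡j  = cong suc i≡j
  ... | inj₂ refl | inj₂ refl = ⊥-elim (diff1-irrefl d)
  F⁺-disj (suc i) (suc j) {_ ∷ _} {_ ∷ _} (inj₂ (inj₁ (eq , eq' , _))) (inj₂ (inj₂ (ne , _))) =
    ⊥-elim (ne (trans eq (sym eq')))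
  F⁺-disj (suc i) (suc j) {_ ∷ _} {_ ∷ _} (inj₂ (inj₂ (ne , _))) (inj₁ (eq , eq' , _)) =
    ⊥-elim (ne (trans eq (sym eq')))
  F⁺-disj (suc i) (suc j) {_ ∷ _} {_ ∷ _} (inj₂ (inj₂ (ne , _))) (inj₂ (inj₁ (eq , eq' , _))) =
    ⊥-elim (ne (trans eq (sym eq')))
  F⁺-disj (suc i) (suc j) {_ ∷ _} {_ ∷ _}
    (inj₂ (inj₂ (_ , _ , refl))) (inj₂ (inj₂ (_ , _ , eq))) = cong suc (flip-injective p eq)

  U⁺-meet₀ : ∀ j {x} → U⁺ zero x → U⁺ (suc j) x → P⁺ x
  U⁺-meet₀ j {_ ∷ _} (inj₂ Px) _ = Px
  U⁺-meet₀ j {_ ∷ _} (inj₁ refl) (inj₁ (refl , _)) = inj₁ refl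
  U⁺-meet₀ j {_ ∷ _} (inj₁ refl) (inj₂ (refl , w)) = inj₂ (inj₂ (cong (not h ∷_) (W-avoids w)))

  pair-triple : ∀ {x} → Pair p q x → P⁺ (h ∷ x)
  pair-triple (inj₁ refl) = inj₁ refl
  pair-triple (inj₂ refl) = inj₂ (inj₁ refl)

  U⁺-meet : ∀ i j {x} → U⁺ i x → U⁺ j x → i ≡ j ⊎ P⁺ x
  U⁺-meet zero zero _ _ = inj₁ refl
  U⁺-meet zero (suc j) u v = inj₂ (U⁺-meet₀ j u v)
  U⁺-meet (suc i) zero u v = inj₂ (U⁺-meet₀ i v u)
  U⁺-meet (suc i) (suc j) {_ ∷ _} (inj₁ (refl , u)) (inj₁ (_ , v)) =
    Sum.map (cong suc) pair-triple (U-meet u v)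
  U⁺-meet (suc i) (suc j) {_ ∷ _} (inj₁ (refl , _)) (inj₂ (eq , _)) = ⊥-elim (not-¬ refl eq)
  U⁺-meet (suc i) (suc j) {_ ∷ _} (inj₂ (eq , _)) (inj₁ (refl , _)) = ⊥-elim (not-¬ refl eq)
  U⁺-meet (suc i) (suc j) {_ ∷ _} (inj₂ (refl , u)) (inj₂ (_ , v)) =
    Sum.map (cong suc) (inj₂ ∘ inj₂ ∘ cong (not h ∷_)) (W-meet u v)

  net⁺ : Net P⁺
  net⁺ = record
    { F = F⁺ ; U = U⁺ ; F-sym = λ {i} → F⁺-sym i ; F-adj = λ {i} → F⁺-adj i
    ; F-in = λ {i} → F⁺-in i ; F-disj = λ {i} {j} → F⁺-disj i j
    ; U-meet = λ {i} {j} → U⁺-meet i j }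

  walk-h : ∀ j {s} → Pair p q s → Star (F⁺ (suc j)) (h ∷ s) (h ∷ flip p j)
  walk-h j Ps with reach j Ps
  ... | _ , refl , w = Star.gmap (h ∷_) (λ e → inj₁ (refl , refl , e)) w

  walk-h' : ∀ j → Star (F⁺ (suc j)) (not h ∷ r) (not h ∷ flip p j)
  walk-h' j = Star.gmap (not h ∷_) (λ e → inj₂ (inj₁ (refl , refl , e)))
    (Star.reverse ind-sym (W-walk j))

  rung : ∀ j → F⁺ (suc j) (h ∷ flip p j) (not h ∷ flip p j)
  rung j = inj₂ (inj₂ (not-¬ refl , refl , refl))

  module _ (p≁q : ∀ j → flip p j ≢ q) where

    -- The piece `zero` does not connect the terminals. Two of them leave on the spot, the first
    -- after one step, at the neighbour of the centre `h ∷ p` in direction `zero`. If `q` were a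
    -- neighbour of `p`, its exit would already belong to some `suc j`.
    C-h : Fin (suc m) → Q (suc m) → Set
    C-h zero    x = Triple (not h ∷ p) (h ∷ q) (not h ∷ r) x
    C-h (suc j) x = x ≡ h ∷ flip p j

    C-h-disj₀ : ∀ j {x} → C-h zero x → C-h (suc j) x → ⊥
    C-h-disj₀ j (inj₁ refl)        eq = not-¬ refl (sym (∷-injectiveˡ eq))
    C-h-disj₀ j (inj₂ (inj₁ refl)) eq = p≁q j (sym (∷-injectiveʳ eq))
    C-h-disj₀ j (inj₂ (inj₂ refl)) eq = not-¬ refl (sym (∷-injectiveˡ eq))

    C-h-disj : ∀ i j {x} → C-h i x → C-h j x → i ≡ j
    C-h-disj zero    zero    _ _  = refl
    C-h-disj zero    (suc j) c c' = ⊥-elim (C-h-disj₀ j c c')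
    C-h-disj (suc i) zero    c c' = ⊥-elim (C-h-disj₀ i c' c)
    C-h-disj (suc i) (suc j) refl eq = cong suc (flip-injective p (∷-injectiveʳ eq))

    C-h-in : ∀ i {x} → C-h i x → U⁺ i x
    C-h-in zero (inj₁ refl)        = inj₁ refl
    C-h-in zero (inj₂ (inj₁ refl)) = inj₂ (inj₂ (inj₁ refl))
    C-h-in zero (inj₂ (inj₂ refl)) = inj₂ (inj₂ (inj₂ refl))
    C-h-in (suc j) refl            = inj₁ (refl , C-in refl)

    C-h-reach : ∀ i {x} → P⁺ x → ∃ λ c → C-h i c × Star (F⁺ i) x c
    C-h-reach zero (inj₁ refl)           = _ , inj₁ refl , (not-¬ refl , refl , refl) ◅ ε
    C-h-reach zero (inj₂ Px)             = _ , inj₂ Px , ε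
    C-h-reach (suc j) (inj₁ refl)        = _ , refl , walk-h j (inj₁ refl)
    C-h-reach (suc j) (inj₂ (inj₁ refl)) = _ , refl , walk-h j (inj₂ refl)
    C-h-reach (suc j) (inj₂ (inj₂ refl)) = _ , refl , walk-h' j ◅◅ (F⁺-sym (suc j) (rung j) ◅ ε)

    centredSide-h : CentredSide P⁺
    centredSide-h = record
      { C = C-h
      ; side = record { net = net⁺ ; C-disj = λ {i} {j} → C-h-disj i j ; C-in = λ {i} → C-h-in i
                      ; reach = C-h-reach }
      ; centre = h ∷ p
      ; centre-C = λ { zero → inj₁ refl ; (suc j) → refl } }

  module _ (p≁r : ∀ j → flip p j ≢ r) where

    -- With the centre moved to `not h ∷ p`, the neighbour in direction `zero` is the terminal
    -- `h ∷ p` itself, so all three terminals leave on the spot. Now it is `r` whose exit would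
    -- clash if it were some `flip p j`.
    C-h' : Fin (suc m) → Q (suc m) → Set
    C-h' zero    x = P⁺ x
    C-h' (suc j) x = x ≡ not h ∷ flip p j

    C-h'-disj₀ : ∀ j {x} → C-h' zero x → C-h' (suc j) x → ⊥
    C-h'-disj₀ j (inj₁ refl)        eq = not-¬ refl (∷-injectiveˡ eq)
    C-h'-disj₀ j (inj₂ (inj₁ refl)) eq = not-¬ refl (∷-injectiveˡ eq)
    C-h'-disj₀ j (inj₂ (inj₂ refl)) eq = p≁r j (sym (∷-injectiveʳ eq))

    C-h'-disj : ∀ i j {x} → C-h' i x → C-h' j x → i ≡ j
    C-h'-disj zero    zero    _ _  = refl
    C-h'-disj zero    (suc j) c c' = ⊥-elim (C-h'-disj₀ j c c')
    C-h'-disj (suc i) zero    c c' = ⊥-elim (C-h'-disj₀ i c' c)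
    C-h'-disj (suc i) (suc j) refl eq = cong suc (flip-injective p (∷-injectiveʳ eq))

    C-h'-in : ∀ i {x} → C-h' i x → U⁺ i x
    C-h'-in zero {_ ∷ _} Px = inj₂ Px
    C-h'-in (suc j) refl    = inj₂ (refl , W-starts j)

    C-h'-reach : ∀ i {x} → P⁺ x → ∃ λ c → C-h' i c × Star (F⁺ i) x c
    C-h'-reach zero Px                    = _ , Px , ε
    C-h'-reach (suc j) (inj₁ refl)        = _ , refl , walk-h j (inj₁ refl) ◅◅ (rung j ◅ ε)
    C-h'-reach (suc j) (inj₂ (inj₁ refl)) = _ , refl , walk-h j (inj₂ refl) ◅◅ (rung j ◅ ε)
    C-h'-reach (suc j) (inj₂ (inj₂ refl)) = _ , refl , walk-h' j

    centredSide-h' : CentredSide P⁺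
    centredSide-h' = record
      { C = C-h'
      ; side = record { net = net⁺ ; C-disj = λ {i} {j} → C-h'-disj i j ; C-in = λ {i} → C-h'-in i
                      ; reach = C-h'-reach }
      ; centre = not h ∷ p
      ; centre-C = λ { zero → inj₁ (cong (_∷ p) (not-involutive h)) ; (suc j) → refl } }

centredSide-resp : {P P' : Q m → Set} → (∀ {x} → P x → P' x) → (∀ {x} → P' x → P x) →
  CentredSide P → CentredSide P'
centredSide-resp to from cs = record
  { C = C ; side = side-resp to from side ; centre = centre ; centre-C = centre-C }
  where open CentredSide cs

parity : Q m → Bool
parity []          = false
parity (true ∷ q)  = not (parity q)
parity (false ∷ q) = parity q

parity-flip : (q : Q m) (i : Fin m) → parity (flip q i) ≡ not (parity q)
parity-flip (true ∷ q)  zero    = sym (not-involutive _)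
parity-flip (false ∷ q) zero    = refl
parity-flip (true ∷ q)  (suc i) = cong not (parity-flip q i)
parity-flip (false ∷ q) (suc i) = parity-flip q i

-- The cube is bipartite: the two sides are an even and an odd number of flips away from `p`, so
-- their parities differ.
triangle-free : (p : Q m) {i j k : Fin m} → flip (flip p i) j ≢ flip p k
triangle-free p {i} {j} {k} eq = not-¬ {x = parity (flip p k)} refl
  (trans (cong parity (sym eq)) (trans (parity-flip (flip p i) j)
    (cong not (trans (parity-flip p i) (sym (parity-flip p k))))))

adjacent? : (p q : Q m) → Dec (∃ λ j → flip p j ≡ q)
adjacent? p q = any? (λ j → flip p j ≟ᵠ q)

-- As the cube has no triangles, one of the three pairs p q, p r, q r is not adjacent.
centredSide-split : (h : Bool) (p q r : Q m) →
  CentredSide (Triple (h ∷ p) (h ∷ q) (not h ∷ r))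
centredSide-split h p q r with adjacent? p q | adjacent? p r
... | no p≁q | _      = Split.centredSide-h h p q r (λ j eq → p≁q (j , eq))
... | yes _  | no p≁r = Split.centredSide-h' h p q r (λ j eq → p≁r (j , eq))
... | yes (i , refl) | yes (j , refl) =
  centredSide-resp exchange exchange
    (Split.centredSide-h' h q p r (λ k eq → triangle-free p eq))
  where
  exchange : ∀ {a b c x : Q (suc _)} → Triple a b c x → Triple b a c x
  exchange (inj₁ eq)        = inj₂ (inj₁ eq)
  exchange (inj₂ (inj₁ eq)) = inj₁ eq
  exchange (inj₂ (inj₂ eq)) = inj₂ (inj₂ eq)

rotate : ∀ {a b c x : Q m} → Triple a b c x → Triple b c a x
rotate (inj₁ eq)        = inj₂ (inj₂ eq)
rotate (inj₂ (inj₁ eq)) = inj₁ eq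
rotate (inj₂ (inj₂ eq)) = inj₂ (inj₁ eq)

-- The cube is halved along its first coordinate until the terminals fall into both halves, which
-- happens because they are distinct. Two of them then share a half; which two decides the rotation.
centredSide : {p q r : Q m} → p ≢ q → p ≢ r → q ≢ r → CentredSide (Triple p q r)
centredSide {p = []} {[]} p≢q _ _ = ⊥-elim (p≢q refl)
centredSide {p = h ∷ p} {k ∷ q} {l ∷ r} p≢q p≢r q≢r with k ≟ᵇ h | l ≟ᵇ h
... | yes refl | yes refl = centredSide-cons h
    (Sum.map (cong (h ∷_)) (Sum.map (cong (h ∷_)) (cong (h ∷_))))
    (λ { (inj₁ refl) → refl , inj₁ refl ; (inj₂ (inj₁ refl)) → refl , inj₂ (inj₁ refl)
       ; (inj₂ (inj₂ refl)) → refl , inj₂ (inj₂ refl) })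
    (centredSide (p≢q ∘ cong (h ∷_)) (p≢r ∘ cong (h ∷_)) (q≢r ∘ cong (h ∷_)))
... | yes refl | no l≢h with ¬-not l≢h
...   | refl = centredSide-split h p q r
centredSide {p = h ∷ p} {k ∷ q} {l ∷ r} p≢q p≢r q≢r | no k≢h | yes refl with ¬-not k≢h
...   | refl = centredSide-resp rotate (rotate ∘ rotate) (centredSide-split h r p q)
centredSide {p = h ∷ p} {k ∷ q} {l ∷ r} p≢q p≢r q≢r | no k≢h | no l≢h
  with ¬-not (k≢h ∘ sym) | trans (¬-not k≢h) (sym (¬-not l≢h))
...   | refl | refl = centredSide-resp (rotate ∘ rotate) rotate (centredSide-split k q r p)

-- The dual cube: exchange of classes, and edge relations given cluster by cluster

V : ℕ → Set
V m = DVertex (suc m)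

family-resp : {A : Set} {Adj : A → A → Set} {S S' : A → Set} →
  (∀ {v} → S v → S' v) → (∀ {v} → S' v → S v) → Family Adj S m → Family Adj S' m
family-resp to from f = record
  { E = E ; E-sym = E-sym ; E-adj = E-adj ; E-disj = E-disj
  ; E-meet = λ e e' → Sum.map₂ to (E-meet e e') ; hub = hub ; reach = λ i → reach i ∘ from }
  where open Family f

-- This automorphism of the dual cube exchanges the classes, so the first of the two clusters may be
-- assumed to have class 0.
mirror : V m → V m
mirror (x , y , c) = y , x , not c

mirror-involutive : (v : V m) → mirror (mirror v) ≡ v
mirror-involutive (x , y , c) = cong (λ c → x , y , c) (not-involutive c)

mirror-adj : (u v : V m) → DAdj (suc m) (mirror u) (mirror v) → DAdj (suc m) u v
mirror-adj (x , y , c) (x' , y' , c') (inj₁ (e , e' , p , d)) =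
  inj₂ (inj₁ (not-injective e , not-injective e' , p , d))
mirror-adj (x , y , c) (x' , y' , c') (inj₂ (inj₁ (e , e' , p , d))) =
  inj₁ (not-injective e , not-injective e' , p , d)
mirror-adj (x , y , c) (x' , y' , c') (inj₂ (inj₂ (p , q , ne))) =
  inj₂ (inj₂ (q , p , ne ∘ cong not))

family-mirror : {S : V m → Set} → Family (DAdj (suc m)) (S ∘ mirror) m → Family (DAdj (suc m)) S m
family-mirror {m} {S} f = record
  { E = λ i u v → E i (mirror u) (mirror v)
  ; E-sym = E-sym ; E-adj = λ e → mirror-adj _ _ (E-adj e) ; E-disj = E-disj
  ; E-meet = λ {i} {j} {u} e e' → Sum.map₂ (subst S (mirror-involutive u)) (E-meet e e')
  ; hub = mirror ∘ hub
  ; reach = λ i {s} Ss → subst (λ s → Star _ s _) (mirror-involutive s)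
      (Star.gmap mirror
        (λ {u} {v} e → subst₂ (E _) (sym (mirror-involutive u)) (sym (mirror-involutive v)) e)
        (reach i (subst S (sym (mirror-involutive s)) Ss))) }
  where open Family f

-- Row i y are the edges of the i-th tree inside the class 0 cluster y, Col i x those inside the
-- class 1 cluster x, and Cross i x y tells whether the edge from (x , y , 0) to (x , y , 1) is used.
module _ {m} (Row Col : Fin m → Q m → Q m → Q m → Set) (Cross : Fin m → Q m → Q m → Set) where

  Woven : Fin m → V m → V m → Set
  Woven i (x , y , false) (x' , y' , false) = y ≡ y' × Row i y x x'
  Woven i (x , y , true)  (x' , y' , true)  = x ≡ x' × Col i x y y'
  Woven i (x , y , false) (x' , y' , true)  = x ≡ x' × y ≡ y' × Cross i x y
  Woven i (x , y , true)  (x' , y' , false) = x ≡ x' × y ≡ y' × Cross i x y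

record Web {m} (S : V m → Set) : Set₁ where
  field
    Row Col    : Fin m → Q m → Q m → Q m → Set
    Cross      : Fin m → Q m → Q m → Set
    Own₀ Own₁  : Fin m → Q m → Q m → Set
    Row-sym    : ∀ {i y x x'} → Row i y x x' → Row i y x' x
    Col-sym    : ∀ {i x y y'} → Col i x y y' → Col i x y' y
    Row-adj    : ∀ {i y x x'} → Row i y x x' → Diff1 x x'
    Col-adj    : ∀ {i x y y'} → Col i x y y' → Diff1 y y'
    Row-own    : ∀ {i y x x'} → Row i y x x' → Own₀ i x y
    Col-own    : ∀ {i x y y'} → Col i x y y' → Own₁ i x y
    Cross-own₀ : ∀ {i x y} → Cross i x y → Own₀ i x y
    Cross-own₁ : ∀ {i x y} → Cross i x y → Own₁ i x y
    Row-disj   : ∀ {i j y x x'} → Row i y x x' → Row j y x x' → i ≡ j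
    Col-disj   : ∀ {i j x y y'} → Col i x y y' → Col j x y y' → i ≡ j
    Cross-disj : ∀ {i j x y} → Cross i x y → Cross j x y → i ≡ j
    Own₀-meet  : ∀ {i j x y} → Own₀ i x y → Own₀ j x y → i ≡ j ⊎ S (x , y , false)
    Own₁-meet  : ∀ {i j x y} → Own₁ i x y → Own₁ j x y → i ≡ j ⊎ S (x , y , true)
    hub        : Fin m → V m
    reach      : ∀ i {s} → S s → Star (Woven Row Col Cross i) s (hub i)

web-family : {S : V m → Set} → Web S → Family (DAdj (suc m)) S m
web-family {m} {S} web = record
  { E = E ; E-sym = λ {i} {u} {v} → E-sym u v ; E-adj = λ {i} {u} {v} → E-adj u v
  ; E-disj = λ {i} {j} {u} {v} → E-disj u v
  ; E-meet = λ {i} {j} {u} {v} {w} e e' → meet u (E-own u v e) (E-own u w e')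
  ; hub = hub ; reach = reach }
  where
  open Web web
  E : Fin m → V m → V m → Set
  E = Woven Row Col Cross
  Own : Fin m → V m → Set
  Own i (x , y , false) = Own₀ i x y
  Own i (x , y , true)  = Own₁ i x y
  E-sym : ∀ {i} u v → E i u v → E i v u
  E-sym (_ , _ , false) (_ , _ , false) (refl , e)      = refl , Row-sym e
  E-sym (_ , _ , true)  (_ , _ , true)  (refl , e)      = refl , Col-sym e
  E-sym (_ , _ , false) (_ , _ , true)  (refl , refl , e) = refl , refl , e
  E-sym (_ , _ , true)  (_ , _ , false) (refl , refl , e) = refl , refl , e
  E-adj : ∀ {i} u v → E i u v → DAdj (suc m) u v
  E-adj (_ , _ , false) (_ , _ , false) (eq , e)       = inj₁ (refl , refl , eq , Row-adj e)
  E-adj (_ , _ , true)  (_ , _ , true)  (eq , e)       = inj₂ (inj₁ (refl , refl , eq , Col-adj e))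
  E-adj (_ , _ , false) (_ , _ , true)  (eq , eq' , _) = inj₂ (inj₂ (eq , eq' , λ ()))
  E-adj (_ , _ , true)  (_ , _ , false) (eq , eq' , _) = inj₂ (inj₂ (eq , eq' , λ ()))
  E-own : ∀ {i} u v → E i u v → Own i u
  E-own (_ , _ , false) (_ , _ , false) (_ , e)     = Row-own e
  E-own (_ , _ , true)  (_ , _ , true)  (_ , e)     = Col-own e
  E-own (_ , _ , false) (_ , _ , true)  (_ , _ , e) = Cross-own₀ e
  E-own (_ , _ , true)  (_ , _ , false) (_ , _ , e) = Cross-own₁ e
  E-disj : ∀ {i j} u v → E i u v → E j u v → i ≡ j
  E-disj (_ , _ , false) (_ , _ , false) (_ , e)     (_ , e')     = Row-disj e e'
  E-disj (_ , _ , true)  (_ , _ , true)  (_ , e)     (_ , e')     = Col-disj e e'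
  E-disj (_ , _ , false) (_ , _ , true)  (_ , _ , e) (_ , _ , e') = Cross-disj e e'
  E-disj (_ , _ , true)  (_ , _ , false) (_ , _ , e) (_ , _ , e') = Cross-disj e e'
  meet : ∀ {i j} u → Own i u → Own j u → i ≡ j ⊎ S u
  meet (_ , _ , false) = Own₀-meet
  meet (_ , _ , true)  = Own₁-meet

-- Joining two terminal clusters

-- The i-th tree leaves the clusters b and b' of class 0 at the positions C i and f i and closes
-- up through the cluster β i.
module SameClass {m} {P P' : Q m → Set} {C : Fin m → Q m → Set} {f : Fin m → Q m}
  {b b' : Q m} (b≢b' : b ≢ b') (side : Side P C) (side' : Side P' (λ i x → x ≡ f i))
  (compatible : ∀ {i j} → C i (f j) → i ≡ j)
  (β : Fin m → Q m) (β-inj : ∀ {i j} → β i ≡ β j → i ≡ j)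
  (β≢b : ∀ i → β i ≢ b) (β≢b' : ∀ i → β i ≢ b')
  (S : V m → Set) (P⇒S : ∀ {x} → P x → S (x , b , false)) (P'⇒S : ∀ {x} → P' x → S (x , b' , false))
  (S-only : ∀ {v} → S v → (∃ λ x → P x × v ≡ (x , b , false)) ⊎ (∃ λ x → P' x × v ≡ (x , b' , false)))
  where

  private
    module A = Side side
    module B = Side side'

    Column : Fin m → Q m → Set
    Column i x = C i x ⊎ x ≡ f i

    column-disj : ∀ {i j x} → Column i x → Column j x → i ≡ j
    column-disj (inj₁ c) (inj₁ c')       = A.C-disj c c'
    column-disj (inj₁ c) (inj₂ refl)     = compatible c
    column-disj (inj₂ refl) (inj₁ c)     = sym (compatible c)
    column-disj (inj₂ refl) (inj₂ eq)    = B.C-disj refl eq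

    Row : Fin m → Q m → Q m → Q m → Set
    Row i y x x' = (y ≡ b × A.F i x x') ⊎ (y ≡ b' × B.F i x x') ⊎ (y ≡ β i × Diff1 x x')

    Col : Fin m → Q m → Q m → Q m → Set
    Col i x y y' = Column i x × Diff1 y y'

    Cross : Fin m → Q m → Q m → Set
    Cross i x y = (y ≡ b × C i x) ⊎ (y ≡ b' × x ≡ f i) ⊎ (y ≡ β i × Column i x)

    Own₀ : Fin m → Q m → Q m → Set
    Own₀ i x y = (y ≡ b × A.U i x) ⊎ (y ≡ b' × B.U i x) ⊎ y ≡ β i

    cross-column : ∀ {i x y} → Cross i x y → Column i x
    cross-column (inj₁ (_ , c))         = inj₁ c
    cross-column (inj₂ (inj₁ (_ , eq))) = inj₂ eq
    cross-column (inj₂ (inj₂ (_ , c)))  = c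

    Row-disj : ∀ {i j y x x'} → Row i y x x' → Row j y x x' → i ≡ j
    Row-disj (inj₁ (_ , e))           (inj₁ (_ , e'))           = A.F-disj e e'
    Row-disj (inj₁ (refl , _))        (inj₂ (inj₁ (eq , _)))    = ⊥-elim (b≢b' eq)
    Row-disj (inj₁ (refl , _))        (inj₂ (inj₂ (eq , _)))    = ⊥-elim (β≢b _ (sym eq))
    Row-disj (inj₂ (inj₁ (eq , _)))   (inj₁ (refl , _))         = ⊥-elim (b≢b' eq)
    Row-disj (inj₂ (inj₁ (_ , e)))    (inj₂ (inj₁ (_ , e')))    = B.F-disj e e'
    Row-disj (inj₂ (inj₁ (refl , _))) (inj₂ (inj₂ (eq , _)))    = ⊥-elim (β≢b' _ (sym eq))
    Row-disj (inj₂ (inj₂ (refl , _))) (inj₁ (eq , _))           = ⊥-elim (β≢b _ eq)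
    Row-disj (inj₂ (inj₂ (refl , _))) (inj₂ (inj₁ (eq , _)))    = ⊥-elim (β≢b' _ eq)
    Row-disj (inj₂ (inj₂ (refl , _))) (inj₂ (inj₂ (eq , _)))    = β-inj eq

    Own₀-meet : ∀ {i j x y} → Own₀ i x y → Own₀ j x y → i ≡ j ⊎ S (x , y , false)
    Own₀-meet (inj₁ (refl , u))        (inj₁ (_ , u'))        = Sum.map₂ P⇒S (A.U-meet u u')
    Own₀-meet (inj₁ (refl , _))        (inj₂ (inj₁ (eq , _))) = ⊥-elim (b≢b' eq)
    Own₀-meet (inj₁ (refl , _))        (inj₂ (inj₂ eq))       = ⊥-elim (β≢b _ (sym eq))
    Own₀-meet (inj₂ (inj₁ (eq , _)))   (inj₁ (refl , _))      = ⊥-elim (b≢b' eq)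
    Own₀-meet (inj₂ (inj₁ (refl , u))) (inj₂ (inj₁ (_ , u'))) = Sum.map₂ P'⇒S (B.U-meet u u')
    Own₀-meet (inj₂ (inj₁ (refl , _))) (inj₂ (inj₂ eq))       = ⊥-elim (β≢b' _ (sym eq))
    Own₀-meet (inj₂ (inj₂ refl))       (inj₁ (eq , _))        = ⊥-elim (β≢b _ eq)
    Own₀-meet (inj₂ (inj₂ refl))       (inj₂ (inj₁ (eq , _))) = ⊥-elim (β≢b' _ eq)
    Own₀-meet (inj₂ (inj₂ refl))       (inj₂ (inj₂ eq))       = inj₁ (β-inj eq)

    E : Fin m → V m → V m → Set
    E = Woven Row Col Cross

    column-walk : ∀ {i x} → Column i x → ∀ y y' → Star (E i) (x , y , true) (x , y' , true)
    column-walk c y y' = Star.gmap (λ y → _ , y , true) (λ d → refl , c , d) (cube-connected y y')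

    hub-row-walk : ∀ {i} x x' → Star (E i) (x , β i , false) (x' , β i , false)
    hub-row-walk x x' =
      Star.gmap (λ x → x , _ , false) (λ d → refl , inj₂ (inj₂ (refl , d))) (cube-connected x x')

    -- The route goes from `b` through the class 1 cluster `c` to the cluster `β i`, across it to
    -- position `f i`, and through the class 1 cluster `f i` to `b'`. All exits of index `i` meet in
    -- `β i`, which reunites a piece that falls apart inside `b`.
    reach : ∀ i {s} → S s → Star (E i) s (f i , b' , false)
    reach i Ss with S-only Ss
    ... | inj₁ (x , Px , refl) with A.reach i Px
    ... | c , Cc , w =
      Star.gmap (λ x → x , b , false) (λ e → refl , inj₁ (refl , e)) w ◅◅
      (refl , refl , inj₁ (refl , Cc)) ◅ column-walk (inj₁ Cc) b (β i) ◅◅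
      (refl , refl , inj₂ (inj₂ (refl , inj₁ Cc))) ◅ hub-row-walk c (f i) ◅◅
      (refl , refl , inj₂ (inj₂ (refl , inj₂ refl))) ◅ column-walk (inj₂ refl) (β i) b' ◅◅
      (refl , refl , inj₂ (inj₁ (refl , refl))) ◅ ε
    reach i Ss | inj₂ (x , P'x , refl) with B.reach i P'x
    ... | _ , refl , w = Star.gmap (λ x → x , b' , false) (λ e → refl , inj₂ (inj₁ (refl , e))) w

  sameClass : Family (DAdj (suc m)) S m
  sameClass = web-family record
    { Row = Row ; Col = Col ; Cross = Cross ; Own₀ = Own₀ ; Own₁ = λ i x _ → Column i x
    ; Row-sym = Sum.map (λ (eq , e) → eq , A.F-sym e)
        (Sum.map (λ (eq , e) → eq , B.F-sym e) (λ (eq , d) → eq , diff1-sym d))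
    ; Col-sym = λ (c , d) → c , diff1-sym d
    ; Row-adj = [ A.F-adj ∘ proj₂ , [ B.F-adj ∘ proj₂ , proj₂ ]′ ]′
    ; Col-adj = proj₂
    ; Row-own = Sum.map (λ (eq , e) → eq , A.F-in e) (Sum.map (λ (eq , e) → eq , B.F-in e) proj₁)
    ; Col-own = proj₁
    ; Cross-own₀ = Sum.map (λ (eq , c) → eq , A.C-in c) (Sum.map (λ (eq , c) → eq , B.C-in c) proj₁)
    ; Cross-own₁ = cross-column
    ; Row-disj = Row-disj
    ; Col-disj = λ (c , _) (c' , _) → column-disj c c'
    ; Cross-disj = λ e e' → column-disj (cross-column e) (cross-column e')
    ; Own₀-meet = Own₀-meet
    ; Own₁-meet = λ c c' → inj₁ (column-disj c c')
    ; hub = λ i → f i , b' , false ; reach = reach }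

-- The i-th tree runs from the positions C i of the class 0 cluster b through the cluster r i
-- to the position r i of the class 1 cluster a; when a itself is among the positions C i, it
-- uses the edge joining the two clusters.
module OppositeClass {m} {P R : Q m → Set} {C : Fin m → Q m → Set} {r : Fin m → Q m}
  {a b : Q m} (side : Side P C) (side' : Side R (λ i y → y ≡ r i))
  (r≢b : ∀ i → r i ≢ b)
  (direct : ∀ {i} → C i a → Side.U side' i b × Star (Side.F side' i) b (r i))
  (S : V m → Set) (P⇒S : ∀ {x} → P x → S (x , b , false)) (R⇒S : ∀ {y} → R y → S (a , y , true))
  (S-only : ∀ {v} → S v → (∃ λ x → P x × v ≡ (x , b , false)) ⊎ (∃ λ y → R y × v ≡ (a , y , true)))
  where

  private
    module A = Side side
    module B = Side side'

    Row : Fin m → Q m → Q m → Q m → Set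
    Row i y x x' = (y ≡ b × A.F i x x') ⊎ (y ≡ r i × Diff1 x x')

    Col : Fin m → Q m → Q m → Q m → Set
    Col i x y y' = (x ≡ a × B.F i y y') ⊎ ((C i x × x ≢ a) × Diff1 y y')

    Cross : Fin m → Q m → Q m → Set
    Cross i x y = (y ≡ b × C i x) ⊎ (y ≡ r i × (x ≡ a ⊎ C i x))

    Own₀ : Fin m → Q m → Q m → Set
    Own₀ i x y = (y ≡ b × A.U i x) ⊎ y ≡ r i

    Own₁ : Fin m → Q m → Q m → Set
    Own₁ i x y = (x ≡ a × B.U i y) ⊎ (C i x × x ≢ a)

    Cross-own₁ : ∀ {i x y} → Cross i x y → Own₁ i x y
    Cross-own₁ {x = x} (inj₁ (refl , c)) with x ≟ᵠ a
    -- The cross edge at position `a` of the cluster `b` ends at position `b` of the cluster `a`, so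
    -- the i-th piece of that cluster has to contain `b`.
    ... | yes refl = inj₁ (refl , proj₁ (direct c))
    ... | no  x≢a  = inj₂ (c , x≢a)
    Cross-own₁ (inj₂ (refl , inj₁ eq)) = inj₁ (eq , B.C-in refl)
    Cross-own₁ {x = x} (inj₂ (refl , inj₂ c)) with x ≟ᵠ a
    ... | yes eq  = inj₁ (eq , B.C-in refl)
    ... | no  x≢a = inj₂ (c , x≢a)

    Row-disj : ∀ {i j y x x'} → Row i y x x' → Row j y x x' → i ≡ j
    Row-disj (inj₁ (_ , e))    (inj₁ (_ , e'))   = A.F-disj e e'
    Row-disj (inj₁ (refl , _)) (inj₂ (eq , _))   = ⊥-elim (r≢b _ (sym eq))
    Row-disj (inj₂ (refl , _)) (inj₁ (eq , _))   = ⊥-elim (r≢b _ eq)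
    Row-disj (inj₂ (refl , _)) (inj₂ (eq , _))   = B.C-disj refl eq

    Col-disj : ∀ {i j x y y'} → Col i x y y' → Col j x y y' → i ≡ j
    Col-disj (inj₁ (_ , e))        (inj₁ (_ , e'))       = B.F-disj e e'
    Col-disj (inj₁ (eq , _))       (inj₂ ((_ , ne) , _)) = ⊥-elim (ne eq)
    Col-disj (inj₂ ((_ , ne) , _)) (inj₁ (eq , _))       = ⊥-elim (ne eq)
    Col-disj (inj₂ ((c , _) , _))  (inj₂ ((c' , _) , _)) = A.C-disj c c'

    Cross-disj : ∀ {i j x y} → Cross i x y → Cross j x y → i ≡ j
    Cross-disj (inj₁ (_ , c))    (inj₁ (_ , c'))  = A.C-disj c c'
    Cross-disj (inj₁ (refl , _)) (inj₂ (eq , _))  = ⊥-elim (r≢b _ (sym eq))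
    Cross-disj (inj₂ (refl , _)) (inj₁ (eq , _))  = ⊥-elim (r≢b _ eq)
    Cross-disj (inj₂ (refl , _)) (inj₂ (eq , _))  = B.C-disj refl eq

    Own₀-meet : ∀ {i j x y} → Own₀ i x y → Own₀ j x y → i ≡ j ⊎ S (x , y , false)
    Own₀-meet (inj₁ (refl , u)) (inj₁ (_ , u')) = Sum.map₂ P⇒S (A.U-meet u u')
    Own₀-meet (inj₁ (refl , _)) (inj₂ eq)       = ⊥-elim (r≢b _ (sym eq))
    Own₀-meet (inj₂ refl)       (inj₁ (eq , _)) = ⊥-elim (r≢b _ eq)
    Own₀-meet (inj₂ refl)       (inj₂ eq)       = inj₁ (B.C-disj refl eq)

    Own₁-meet : ∀ {i j x y} → Own₁ i x y → Own₁ j x y → i ≡ j ⊎ S (x , y , true)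
    Own₁-meet (inj₁ (refl , u)) (inj₁ (_ , u'))  = Sum.map₂ R⇒S (B.U-meet u u')
    Own₁-meet (inj₁ (eq , _))   (inj₂ (_ , ne))  = ⊥-elim (ne eq)
    Own₁-meet (inj₂ (_ , ne))   (inj₁ (eq , _))  = ⊥-elim (ne eq)
    Own₁-meet (inj₂ (c , _))    (inj₂ (c' , _))  = inj₁ (A.C-disj c c')

    E : Fin m → V m → V m → Set
    E = Woven Row Col Cross

    a-walk : ∀ {i y y'} → Star (B.F i) y y' → Star (E i) (a , y , true) (a , y' , true)
    a-walk = Star.gmap (λ y → a , y , true) (λ e → refl , inj₁ (refl , e))

    leave : ∀ {i c} → C i c → Star (E i) (c , b , true) (a , r i , true)
    leave {i} {c} Cc with c ≟ᵠ a
    ... | yes refl = a-walk (proj₂ (direct Cc))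
    ... | no  c≢a  =
      Star.gmap (λ y → c , y , true) (λ d → refl , inj₂ ((Cc , c≢a) , d)) (cube-connected b (r i)) ◅◅
      (refl , refl , inj₂ (refl , inj₂ Cc)) ◅
      Star.gmap (λ x → x , r i , false) (λ d → refl , inj₂ (refl , d)) (cube-connected c a) ◅◅
      (refl , refl , inj₂ (refl , inj₁ refl)) ◅ ε

    reach : ∀ i {s} → S s → Star (E i) s (a , r i , true)
    reach i Ss with S-only Ss
    ... | inj₁ (x , Px , refl) with A.reach i Px
    ... | c , Cc , w =
      Star.gmap (λ x → x , b , false) (λ e → refl , inj₁ (refl , e)) w ◅◅
      (refl , refl , inj₁ (refl , Cc)) ◅ leave Cc
    reach i Ss | inj₂ (y , Ry , refl) with B.reach i Ry
    ... | _ , refl , w = a-walk w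

  oppositeClass : Family (DAdj (suc m)) S m
  oppositeClass = web-family record
    { Row = Row ; Col = Col ; Cross = Cross ; Own₀ = Own₀ ; Own₁ = Own₁
    ; Row-sym = Sum.map (λ (eq , e) → eq , A.F-sym e) (λ (eq , d) → eq , diff1-sym d)
    ; Col-sym = Sum.map (λ (eq , e) → eq , B.F-sym e) (λ (c , d) → c , diff1-sym d)
    ; Row-adj = [ A.F-adj ∘ proj₂ , proj₂ ]′
    ; Col-adj = [ B.F-adj ∘ proj₂ , proj₂ ]′
    ; Row-own = Sum.map (λ (eq , e) → eq , A.F-in e) proj₁
    ; Col-own = Sum.map (λ (eq , e) → eq , B.F-in e) proj₁
    ; Cross-own₀ = Sum.map (λ (eq , c) → eq , A.C-in c) proj₁
    ; Cross-own₁ = Cross-own₁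
    ; Row-disj = Row-disj ; Col-disj = Col-disj ; Cross-disj = Cross-disj
    ; Own₀-meet = Own₀-meet ; Own₁-meet = Own₁-meet
    ; hub = λ i → a , r i , true ; reach = reach }

-- Choosing connecting clusters and matching directions

record DistinctAvoiding {m} (b b' : Q m) : Set where
  field
    β     : Fin m → Q m
    β-inj : ∀ {i j} → β i ≡ β j → i ≡ j
    β≢b   : ∀ i → β i ≢ b
    β≢b'  : ∀ i → β i ≢ b'

-- The neighbours of `b` serve, unless `b'` is one of them. It is then replaced by a neighbour of
-- `b'` other than `b`, which by parity is not a neighbour of `b`; dimension at least two supplies
-- the second direction.
distinctAvoiding : {b b' : Q (suc (suc m))} → b ≢ b' → DistinctAvoiding b b'
distinctAvoiding {m} {b} {b'} b≢b' with adjacent? b b'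
... | no b≁b' = record
  { β = flip b ; β-inj = flip-injective b ; β≢b = flip-≢ b
  ; β≢b' = λ i eq → b≁b' (i , eq) }
... | yes (j , refl) = record { β = β ; β-inj = β-inj ; β≢b = β≢b ; β≢b' = β≢b' }
  where
  other : Fin (suc (suc m)) → Fin (suc (suc m))
  other zero    = suc zero
  other (suc _) = zero
  other-≢ : ∀ j → other j ≢ j
  other-≢ zero    ()
  other-≢ (suc _) ()
  β : Fin (suc (suc m)) → Q (suc (suc m))
  β i with i ≟ᶠ j
  ... | yes _ = flip (flip b j) (other j)
  ... | no  _ = flip b i
  β-inj : ∀ {i k} → β i ≡ β k → i ≡ k
  β-inj {i} {k} eq with i ≟ᶠ j | k ≟ᶠ j
  ... | yes i≡j | yes k≡j = trans i≡j (sym k≡j)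
  ... | yes _   | no  _   = ⊥-elim (triangle-free b eq)
  ... | no  _   | yes _   = ⊥-elim (triangle-free b (sym eq))
  ... | no  _   | no  _   = flip-injective b eq
  β≢b : ∀ i → β i ≢ b
  β≢b i eq with i ≟ᶠ j
  ... | yes _ = other-≢ j (flip-injective (flip b j) (trans eq (sym (flip-involutive b j))))
  ... | no  _ = flip-≢ b i eq
  β≢b' : ∀ i → β i ≢ flip b j
  β≢b' i eq with i ≟ᶠ j
  ... | yes _   = flip-≢ (flip b j) (other j) eq
  ... | no  i≢j = i≢j (flip-injective b eq)

-- Two vertices at distance two have two common neighbours, reached in exchanged directions.
record Alignment {m} (p q : Q m) : Set where
  field
    σ       : Fin m → Fin m
    σ-inj   : ∀ {i j} → σ i ≡ σ j → i ≡ j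
    aligned : ∀ {i j} → flip p i ≡ flip q (σ j) → i ≡ j

-- Where the first coordinates agree, `zero` is matched with itself. Where they differ, a common
-- neighbour arises only by flipping that coordinate on exactly one side, which forces the tails to
-- be adjacent; `σ` then exchanges `zero` with the direction `suc k` in which the tails differ.
alignment : (p q : Q m) → Alignment p q
alignment [] [] = record { σ = id ; σ-inj = id ; aligned = λ { {()} } }
alignment {suc m} (h ∷ p) (k ∷ q) with k ≟ᵇ h
... | yes refl = record { σ = σ⁺ ; σ-inj = σ⁺-inj _ _ ; aligned = λ {i} {j} → aligned⁺ i j }
  where
  open Alignment (alignment p q)
  σ⁺ : Fin (suc m) → Fin (suc m)
  σ⁺ zero    = zero
  σ⁺ (suc i) = suc (σ i)
  σ⁺-inj : ∀ i j → σ⁺ i ≡ σ⁺ j → i ≡ j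
  σ⁺-inj zero    zero    _  = refl
  σ⁺-inj (suc i) (suc j) eq = cong suc (σ-inj (suc-injective eq))
  aligned⁺ : ∀ i j → flip (h ∷ p) i ≡ flip (h ∷ q) (σ⁺ j) → i ≡ j
  aligned⁺ zero    zero    _  = refl
  aligned⁺ zero    (suc j) eq = ⊥-elim (not-¬ refl (sym (∷-injectiveˡ eq)))
  aligned⁺ (suc i) zero    eq = ⊥-elim (not-¬ refl (∷-injectiveˡ eq))
  aligned⁺ (suc i) (suc j) eq = cong suc (aligned (∷-injectiveʳ eq))
... | no k≢h with ¬-not k≢h | adjacent? q p
...   | refl | no q≁p = record { σ = id ; σ-inj = id ; aligned = λ {i} {j} → aligned⁺ i j }
  where
  aligned⁺ : ∀ i j → flip (h ∷ p) i ≡ flip (not h ∷ q) j → i ≡ j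
  aligned⁺ zero    zero    _  = refl
  aligned⁺ zero    (suc j) eq = ⊥-elim (q≁p (j , sym (∷-injectiveʳ eq)))
  aligned⁺ (suc i) zero    eq =
    ⊥-elim (q≁p (i , trans (cong (λ x → flip x i) (sym (∷-injectiveʳ eq))) (flip-involutive p i)))
  aligned⁺ (suc i) (suc j) eq = ⊥-elim (not-¬ refl (∷-injectiveˡ eq))
...   | refl | yes (k , refl) =
  record { σ = σ ; σ-inj = σ-inj _ _ ; aligned = λ {i} {j} → aligned⁺ i j }
  where
  σ : Fin (suc m) → Fin (suc m)
  σ zero    = suc k
  σ (suc i) with i ≟ᶠ k
  ... | yes _ = zero
  ... | no  _ = suc i
  σ-inj : ∀ i j → σ i ≡ σ j → i ≡ j
  σ-inj zero    zero    _ = refl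
  σ-inj zero    (suc j) eq with j ≟ᶠ k
  σ-inj zero    (suc j) () | yes _
  ... | no j≢k = ⊥-elim (j≢k (suc-injective (sym eq)))
  σ-inj (suc i) zero    eq with i ≟ᶠ k
  σ-inj (suc i) zero    () | yes _
  ... | no i≢k = ⊥-elim (i≢k (suc-injective eq))
  σ-inj (suc i) (suc j) eq with i ≟ᶠ k | j ≟ᶠ k
  ... | yes i≡k | yes j≡k = cong suc (trans i≡k (sym j≡k))
  ... | no  _   | no  _   = eq
  σ-inj (suc i) (suc j) () | yes _ | no _
  σ-inj (suc i) (suc j) () | no _  | yes _
  aligned⁺ : ∀ i j → flip (h ∷ flip q k) i ≡ flip (not h ∷ q) (σ j) → i ≡ j
  aligned⁺ zero    zero    _ = refl
  aligned⁺ (suc i) zero    eq = ⊥-elim (not-¬ refl (∷-injectiveˡ eq))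
  aligned⁺ zero    (suc j) eq with j ≟ᶠ k
  ... | yes _   = ⊥-elim (flip-≢ q k (∷-injectiveʳ eq))
  ... | no  j≢k = ⊥-elim (j≢k (sym (flip-injective q (∷-injectiveʳ eq))))
  aligned⁺ (suc i) (suc j) eq with j ≟ᶠ k
  ... | yes refl = cong suc (flip-injective (flip q j) (trans (∷-injectiveʳ eq) (sym (flip-involutive q j))))
  ... | no  _    = ⊥-elim (not-¬ refl (∷-injectiveˡ eq))

-- The four distributions of the terminals

row : Q m → Q m → V m
row b x = x , b , false

column : Q m → Q m → V m
column a y = a , y , true

module _ {A : Set} {f : Q m → A} where

  triple-∈ : ∀ {p q r x S} → Triple p q r x → f x ∈ (f p ∷ f q ∷ f r ∷ S)
  triple-∈ (inj₁ refl)        = here refl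
  triple-∈ (inj₂ (inj₁ refl)) = there (here refl)
  triple-∈ (inj₂ (inj₂ refl)) = there (there (here refl))

  pair-∈ : ∀ {p q x S} → Pair p q x → f x ∈ (f p ∷ f q ∷ S)
  pair-∈ (inj₁ refl) = here refl
  pair-∈ (inj₂ refl) = there (here refl)

  split-3-1 : ∀ {g : Q m → A} {p q r t v} → v ∈ (f p ∷ f q ∷ f r ∷ g t ∷ []) →
    (∃ λ x → Triple p q r x × v ≡ f x) ⊎ (∃ λ x → x ≡ t × v ≡ g x)
  split-3-1 (here eq)                         = inj₁ (_ , inj₁ refl , eq)
  split-3-1 (there (here eq))                 = inj₁ (_ , inj₂ (inj₁ refl) , eq)
  split-3-1 (there (there (here eq)))         = inj₁ (_ , inj₂ (inj₂ refl) , eq)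
  split-3-1 (there (there (there (here eq)))) = inj₂ (_ , refl , eq)

  split-2-2 : ∀ {g : Q m → A} {p q r t v} → v ∈ (f p ∷ f q ∷ g r ∷ g t ∷ []) →
    (∃ λ x → Pair p q x × v ≡ f x) ⊎ (∃ λ x → Pair r t x × v ≡ g x)
  split-2-2 (here eq)                         = inj₁ (_ , inj₁ refl , eq)
  split-2-2 (there (here eq))                 = inj₁ (_ , inj₂ refl , eq)
  split-2-2 (there (there (here eq)))         = inj₂ (_ , inj₁ refl , eq)
  split-2-2 (there (there (there (here eq)))) = inj₂ (_ , inj₂ refl , eq)

Trees : List (V m) → Set₁
Trees {m} S = Family (DAdj (suc m)) (_∈ S) m

-- The fan to the lone terminal `t` starts at the centre of the triple, so that its exits fall into
-- the columns already reserved for the same indices.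
sameClass-3-1 : {b b' p q r : Q (suc (suc m))} (t : Q (suc (suc m))) → b ≢ b' →
  p ≢ q → p ≢ r → q ≢ r → Trees (row b p ∷ row b q ∷ row b r ∷ row b' t ∷ [])
sameClass-3-1 {b = b} {b'} t b≢b' p≢q p≢r q≢r =
  SameClass.sameClass b≢b' side (single-side centre t)
    (λ {i} {j} c → C-disj c (centre-C j))
    β β-inj β≢b β≢b' _ (triple-∈ {f = row b}) (λ { refl → there (there (there (here refl))) })
    split-3-1
  where
  open CentredSide (centredSide p≢q p≢r q≢r)
  open Side side using (C-disj)
  open DistinctAvoiding (distinctAvoiding b≢b')

-- Each pair leaves at the neighbours of one of its terminals. Relabelling the second pair by `σ`
-- gives a common exit position the same index on both sides.
sameClass-2-2 : {b b' : Q (suc (suc m))} (p q r t : Q (suc (suc m))) → b ≢ b' →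
  Trees (row b p ∷ row b q ∷ row b' r ∷ row b' t ∷ [])
sameClass-2-2 {b = b} {b'} p q r t b≢b' =
  SameClass.sameClass b≢b' (pair-side p q) (side-relabel σ σ-inj (pair-side r t))
    (aligned ∘ sym)
    β β-inj β≢b β≢b' _ (pair-∈ {f = row b})
    (λ Rx → there (there (pair-∈ {f = row b'} Rx)))
    split-2-2
  where
  open Alignment (alignment p r)
  open DistinctAvoiding (distinctAvoiding b≢b')

-- The fan to `t` starts at `b`, where the edge joining the two clusters arrives. A tree with `a`
-- among its exits enters at `b` and continues to `flip b i`; the exits being disjoint, at most one
-- tree does so.
oppositeClass-3-1 : {b p q r : Q m} (a t : Q m) → p ≢ q → p ≢ r → q ≢ r →
  Trees (row b p ∷ row b q ∷ row b r ∷ column a t ∷ [])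
oppositeClass-3-1 {b = b} a t p≢q p≢r q≢r =
  OppositeClass.oppositeClass side side' (flip-≢ b)
    (λ c → inj₂ (c , refl) , inj₂ (c , inj₁ (refl , refl)) ◅ ε)
    _ (triple-∈ {f = row b}) (λ { refl → there (there (there (here refl))) })
    split-3-1
  where
  open CentredSide (centredSide p≢q p≢r q≢r)
  side' : Side (_≡ t) (λ i y → y ≡ flip b i)
  side' = fan-side b t (λ i → C i a) refl (λ c c' → inj₁ (Side.C-disj side c c')) inj₁

-- Avoiding `a` rules out the direct edge between the clusters; avoiding `b` keeps the intermediate
-- class 0 clusters, indexed by the exits of the second pair, away from the terminal cluster `b`.
oppositeClass-2-2 : (a b p q r t : Q m) →
  Trees (row b p ∷ row b q ∷ column a r ∷ column a t ∷ [])
oppositeClass-2-2 a b p q r t =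
  OppositeClass.oppositeClass (pair-side-avoiding p q a) (pair-side-avoiding r t b)
    (avoiding-≢ r b)
    (λ {i} eq → ⊥-elim (avoiding-≢ p a i (sym eq)))
    _ (pair-∈ {f = row b})
    (λ Rx → there (there (pair-∈ {f = column a} Rx)))
    split-2-2

trees-mirror : {S : List (V m)} → Trees (map mirror S) → Trees S
trees-mirror {S = S} = family-mirror ∘ family-resp from to
  where
  to : ∀ {v} → mirror v ∈ S → v ∈ map mirror S
  to {v} v∈ = subst (_∈ map mirror S) (mirror-involutive v) (∈-map⁺ mirror v∈)
  from : ∀ {v} → v ∈ map mirror S → mirror v ∈ S
  from v∈ with ∈-map⁻ mirror v∈
  ... | u , u∈ , refl = subst (_∈ S) (sym (mirror-involutive u)) u∈

data Within {m} : ClusterId (suc m) → V m → Set where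
  in₀ : ∀ {b x} → Within (false , b) (row b x)
  in₁ : ∀ {a y} → Within (true , a) (column a y)

within : {K : ClusterId (suc m)} (v : V m) → clusterOf (suc m) v ≡ K → Within K v
within (_ , _ , false) refl = in₀
within (_ , _ , true)  refl = in₁

trees-3-1 : {K L : ClusterId (suc (suc (suc m)))} {x y z w : V (suc (suc m))} → K ≢ L →
  x ≢ y → x ≢ z → y ≢ z → Within K x → Within K y → Within K z → Within L w →
  Trees (x ∷ y ∷ z ∷ w ∷ [])
trees-3-1 K≢L x≢y x≢z y≢z in₀ in₀ in₀ in₀ =
  sameClass-3-1 _ (K≢L ∘ cong (_ ,_)) (x≢y ∘ cong (row _)) (x≢z ∘ cong (row _)) (y≢z ∘ cong (row _))
trees-3-1 K≢L x≢y x≢z y≢z in₀ in₀ in₀ in₁ =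
  oppositeClass-3-1 _ _ (x≢y ∘ cong (row _)) (x≢z ∘ cong (row _)) (y≢z ∘ cong (row _))
trees-3-1 K≢L x≢y x≢z y≢z in₁ in₁ in₁ in₁ = trees-mirror
  (sameClass-3-1 _ (K≢L ∘ cong (_ ,_)) (x≢y ∘ cong (column _)) (x≢z ∘ cong (column _))
    (y≢z ∘ cong (column _)))
trees-3-1 K≢L x≢y x≢z y≢z in₁ in₁ in₁ in₀ = trees-mirror
  (oppositeClass-3-1 _ _ (x≢y ∘ cong (column _)) (x≢z ∘ cong (column _)) (y≢z ∘ cong (column _)))

trees-2-2 : {K L : ClusterId (suc (suc (suc m)))} {x y z w : V (suc (suc m))} → K ≢ L →
  Within K x → Within K y → Within L z → Within L w → Trees (x ∷ y ∷ z ∷ w ∷ [])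
trees-2-2 K≢L in₀ in₀ in₀ in₀ = sameClass-2-2 _ _ _ _ (K≢L ∘ cong (_ ,_))
trees-2-2 K≢L in₀ in₀ in₁ in₁ = oppositeClass-2-2 _ _ _ _ _ _
trees-2-2 K≢L in₁ in₁ in₁ in₁ = trees-mirror (sameClass-2-2 _ _ _ _ (K≢L ∘ cong (_ ,_)))
trees-2-2 K≢L in₁ in₁ in₀ in₀ = trees-mirror (oppositeClass-2-2 _ _ _ _ _ _)

-- Sorting the terminals by cluster

partition-↭ : {A : Set} {P R : A → Set} {xs : List A} → All (λ x → P x ⊎ R x) xs →
  ∃₂ λ ys zs → xs ↭ ys ++ zs × All P ys × All R zs
partition-↭ [] = [] , [] , ↭-refl , [] , []
partition-↭ {xs = x ∷ _} (s ∷ ss) with partition-↭ ss | s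
... | ys , zs , p , Ps , Rs | inj₁ Px = x ∷ ys , zs , prep x p , Px ∷ Ps , Rs
... | ys , zs , p , Ps , Rs | inj₂ Rx =
  ys , x ∷ zs , ↭-trans (prep x p) (↭-sym (shift x ys zs)) , Ps , Rx ∷ Rs

-- A family sees the terminals only through membership, so their order may be changed freely.
trees-↭ : {S S' : List (V m)} → S ↭ S' → Trees S' → Trees S
trees-↭ p = family-resp (∈-resp-↭ (↭-sym p)) (∈-resp-↭ p)

module _ {m} {K L : ClusterId (suc (suc (suc m)))} (K≢L : K ≢ L) where

  private
    cluster : V (suc (suc m)) → ClusterId (suc (suc (suc m)))
    cluster = clusterOf (suc (suc (suc m)))

    impossible : ∀ {K L S zs} → K ≢ L → S ↭ zs → All (λ s → cluster s ≡ L) zs →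
      ¬ Any (λ s → cluster s ≡ K) S
    impossible K≢L p Ls K∈ with find K∈
    ... | s , s∈ , eq = K≢L (trans (sym eq) (All.lookup Ls (∈-resp-↭ p s∈)))

  trees-two-clusters : ∀ {S} → length S ≡ 4 → Unique S →
    Any (λ s → cluster s ≡ K) S → Any (λ s → cluster s ≡ L) S →
    (∃₂ λ ys zs → S ↭ ys ++ zs × All (λ s → cluster s ≡ K) ys × All (λ s → cluster s ≡ L) zs) →
    Trees S
  trees-two-clusters {S} len un K∈ L∈ (ys , zs , p , Ks , Ls) =
    cases ys zs p (trans (sym (↭-length p)) len) Ks Ls
    where
    cases : ∀ ys zs → S ↭ ys ++ zs → length (ys ++ zs) ≡ 4 →
      All (λ s → cluster s ≡ K) ys → All (λ s → cluster s ≡ L) zs → Trees S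
    cases [] zs p _ [] Ls = ⊥-elim (impossible K≢L p Ls K∈)
    cases (x ∷ []) (y ∷ z ∷ w ∷ []) p _ (kx ∷ []) (ly ∷ lz ∷ lw ∷ []) =
      trees-↭ p' (rest (Unique-resp-↭ (setoid _) (↭⇒↭ₛ p') un))
      where
      p' : S ↭ y ∷ z ∷ w ∷ x ∷ []
      p' = ↭-trans p (++-comm (x ∷ []) (y ∷ z ∷ w ∷ []))
      rest : Unique (y ∷ z ∷ w ∷ x ∷ []) → Trees (y ∷ z ∷ w ∷ x ∷ [])
      rest ((y≢z ∷ y≢w ∷ _) ∷ (z≢w ∷ _) ∷ _) = trees-3-1 (K≢L ∘ sym) y≢z y≢w z≢w
        (within y ly) (within z lz) (within w lw) (within x kx)
    cases (x ∷ y ∷ []) (z ∷ w ∷ []) p _ (kx ∷ ky ∷ []) (lz ∷ lw ∷ []) =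
      trees-↭ p (trees-2-2 K≢L (within x kx) (within y ky) (within z lz) (within w lw))
    cases (x ∷ y ∷ z ∷ []) (w ∷ []) p _ (kx ∷ ky ∷ kz ∷ []) (lw ∷ []) =
      trees-↭ p (rest (Unique-resp-↭ (setoid _) (↭⇒↭ₛ p) un))
      where
      rest : Unique (x ∷ y ∷ z ∷ w ∷ []) → Trees (x ∷ y ∷ z ∷ w ∷ [])
      rest ((x≢y ∷ x≢z ∷ _) ∷ (y≢z ∷ _) ∷ _) = trees-3-1 K≢L x≢y x≢z y≢z
        (within x kx) (within y ky) (within z kz) (within w lw)
    cases (x ∷ y ∷ z ∷ w ∷ []) [] p _ Ks [] = ⊥-elim (impossible (K≢L ∘ sym) p Ks L∈)

_≟ᵛ_ : DecidableEquality (V m)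
_≟ᵛ_ = ×-≡-dec _≟ᵠ_ (×-≡-dec _≟ᵠ_ _≟ᵇ_)

theorem8 : (n : ℕ) → 4 ≤ n → (x y z w : DVertex n) →
    Unique (x ∷ y ∷ z ∷ w ∷ []) →
    InExactlyTwoClusters n (x ∷ y ∷ z ∷ w ∷ []) →
    Σ (Fin (n ∸ 1) → SubGraph (DVertex n)) λ T →
    InternallyDisjointSTrees (DAdj n) (x ∷ y ∷ z ∷ w ∷ []) (n ∸ 1) T
theorem8 (suc (suc (suc m))) (s≤s (s≤s (s≤s _))) x y z w un (K , L , K≢L , two , K∈ , L∈) =
  family-trees _≟ᵛ_ (trees-two-clusters K≢L refl un K∈ L∈ (partition-↭ two))
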